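{- Let $\mathcal{C}_{\mathbf{S}\mathbf{K}}$ be the set of all $\mathbf{S}\mathbf{K}$-combinators and $\mathcal{WN}_{\mathbf{S}\mathbf{K}}$ its subset of normalising combinators. Then $$0.34010402598726164\le \mu^{ - }\!\left(\frac{\mathcal{WN}_{\mathbf{S}\mathbf{K}}}{\mathcal{C}_{\mathbf{S}\mathbf{K}}}\right).$$
   Context: $\mathbf{S}\mathbf{K}$-combinators are the terms built from the primitive combinators $\mathbf{S},\mathbf{K}$ by binary application (associating to the left). The size of a combinator is its number of applications. Reduction rules: $\mathbf{S}N_1N_2N_3\to N_1N_3(N_2N_3)$ and $\mathbf{K}N_1N_2\to N_1$, applied to any subterm. A term is in normal form if no rule applies, and normalising if some finite reduction sequence from it ends in a normal form. For $A\subseteq B$ with $a_n,b_n$ the numbers of elements of size $n$ in $A,B$, $\mu^{ - }\left(\frac{A}{B}\right)=\liminf_{n\to\infty}a_n/b_n$. -}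

module Defs where

open import Data.Integer as ℤ using (+_; +≤+)
open import Data.List using (List; []; _∷_; _++_; [_]; length)
open import Data.List.Membership.Propositional using (_∈_)
open import Data.List.Membership.Propositional.Properties
  using (∈-∃++; ∈-++⁺ˡ; ∈-++⁺ʳ; ∈-++⁻)
open import Data.List.Properties using (length-++)
open import Data.List.Relation.Unary.All as All using (All; []; _∷_)
open import Data.List.Relation.Unary.AllPairs using ([]; _∷_)
open import Data.List.Relation.Unary.Any using (here; there)
open import Data.List.Relation.Unary.Unique.Propositional using (Unique)
open import Data.Nat as ℕ using (ℕ; suc; NonZero; z≤n; s≤s)
import Data.Nat.Properties as ℕₚ
open import Data.Product using (Σ; ∃; ∃₂; _×_; _,_; proj₁; proj₂)
open import Data.Rational.Unnormalised using (ℚᵘ; _<_; _≤_; _/_; *≤*)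
open import Data.Rational.Unnormalised.Properties using (<-≤-trans)
open import Data.Sum using (inj₁; inj₂)
open import Function using (_⇔_; mk⇔; Equivalence)
open import Level using (0ℓ)
open import Relation.Binary.PropositionalEquality
  using (_≡_; _≢_; refl; sym; trans; cong; subst)
open import Relation.Binary.Rewriting using (HasNormalForm)
open import Relation.Nullary using (contradiction)
open import Relation.Unary using (Pred; U; _⊆_)

infixl 7 _·_
data Comb : Set where
  S K : Comb
  _·_ : Comb → Comb → Comb

size : Comb → ℕ
size S       = 0
size K       = 0
size (M · N) = suc (size M ℕ.+ size N)

infix 4 _⟶_
data _⟶_ : Comb → Comb → Set where
  S-red : ∀ {N₁ N₂ N₃} → S · N₁ · N₂ · N₃ ⟶ N₁ · N₃ · (N₂ · N₃)
  K-red : ∀ {N₁ N₂} → K · N₁ · N₂ ⟶ N₁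
  appˡ  : ∀ {M M′ N} → M ⟶ M′ → M · N ⟶ M′ · N
  appʳ  : ∀ {M N N′} → N ⟶ N′ → M · N ⟶ M · N′

𝒞 : Pred Comb 0ℓ
𝒞 = U

𝒲𝒩 : Pred Comb 0ℓ
𝒲𝒩 = HasNormalForm _⟶_

-- An (extended) real x is represented by its lower cut { q ∈ ℚ ∣ q < x }.
-- This supports suprema, infima, and hence liminf, of arbitrary sequences.
LowerReal : Set₁
LowerReal = Pred ℚᵘ 0ℓ

infix 4 _≤ᴿ_
_≤ᴿ_ : LowerReal → LowerReal → Set
x ≤ᴿ y = x ⊆ y

fromℚ : ℚᵘ → LowerReal
fromℚ r q = q < r

sup : {I : Set} → (I → LowerReal) → LowerReal
sup x q = ∃ λ i → x i q

-- The plain intersection of cuts need not be open: ⋂ₙ { q ∣ q < 1/(n+1) }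
-- contains 0.  Passing to a strictly larger r makes it so.
inf : {I : Set} → (I → LowerReal) → LowerReal
inf x q = ∃ λ r → q < r × (∀ i → x i r)

liminf : (ℕ → LowerReal) → LowerReal
liminf x = sup λ N → inf {∃ λ n → N ℕ.≤ n} λ (n , _) → x n

-- b is the number of elements of B of size n.
HasCount : Pred Comb 0ℓ → ℕ → ℕ → Set
HasCount B n b = ∃ λ (Ms : List Comb) →
  Unique Ms × (∀ M → M ∈ Ms ⇔ (B M × size M ≡ n)) × length Ms ≡ b

-- The number of elements of A of size n is at least k.  Unlike HasCount, this
-- is meaningful constructively for an undecidable A such as 𝒲𝒩, whose counts
-- cannot be shown to exist without excluded middle.
HasAtLeast : Pred Comb 0ℓ → ℕ → ℕ → Set
HasAtLeast A n k = ∃ λ (Ms : List Comb) →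
  Unique Ms × All (λ M → A M × size M ≡ n) Ms × length Ms ≡ k

-- The quotient aₙ / bₙ of the numbers of elements of size n in A and in B:
-- q < aₙ / bₙ iff q < k / bₙ for some k ≤ aₙ (see ratio-correct below).
ratio : Pred Comb 0ℓ → Pred Comb 0ℓ → ℕ → LowerReal
ratio A B n q = ∃₂ λ k b → HasAtLeast A n k × HasCount B n b ×
  Σ (NonZero b) λ b≢0 → q < _/_ (+ k) b {{b≢0}}

μ⁻ : Pred Comb 0ℓ → Pred Comb 0ℓ → LowerReal
μ⁻ A B = liminf (ratio A B)

private
  pigeonhole : ∀ {Ms Ns : List Comb} → Unique Ms → (∀ {M} → M ∈ Ms → M ∈ Ns) →
               length Ms ℕ.≤ length Ns
  pigeonhole {[]} _ _ = z≤n
  pigeonhole {M ∷ Ms} (M∉ ∷ u) sub with ∈-∃++ (sub (here refl))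
  ... | Ps , Qs , refl = subst (suc (length Ms) ℕ.≤_) eq (s≤s (pigeonhole u sub′))
    where
    eq : suc (length (Ps ++ Qs)) ≡ length (Ps ++ [ M ] ++ Qs)
    eq = trans (cong suc (length-++ Ps))
           (trans (sym (ℕₚ.+-suc (length Ps) (length Qs))) (sym (length-++ Ps)))

    sub′ : ∀ {N} → N ∈ Ms → N ∈ Ps ++ Qs
    sub′ N∈ with ∈-++⁻ Ps (sub (there N∈))
    ... | inj₁ N∈Ps         = ∈-++⁺ˡ N∈Ps
    ... | inj₂ (here refl)  = contradiction refl (All.lookup M∉ N∈)
    ... | inj₂ (there N∈Qs) = ∈-++⁺ʳ Ps N∈Qs

  count⇒atLeast : ∀ {A n a} → HasCount A n a → HasAtLeast A n a
  count⇒atLeast (Ms , u , c , l) =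
    Ms , u , All.tabulate (λ {M} → Equivalence.to (c M)) , l

  atLeast⇒≤ : ∀ {A n k a} → HasAtLeast A n k → HasCount A n a → k ℕ.≤ a
  atLeast⇒≤ (Ms , u , p , refl) (Ns , _ , c , refl) =
    pigeonhole u λ {M} M∈ → Equivalence.from (c M) (All.lookup p M∈)

  count-unique : ∀ {B n b b′} → HasCount B n b → HasCount B n b′ → b ≡ b′
  count-unique h h′ = ℕₚ.≤-antisym
    (atLeast⇒≤ (count⇒atLeast h) h′) (atLeast⇒≤ (count⇒atLeast h′) h)

  /-monoˡ : ∀ {k a} b .{{_ : NonZero b}} → k ℕ.≤ a → (+ k) / b ≤ (+ a) / b
  /-monoˡ {k} {a} (suc b) k≤a =
    *≤* (ℤₚ.*-monoʳ-≤-nonNeg (+ suc b) (+≤+ k≤a))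
    where import Data.Integer.Properties as ℤₚ

ratio-correct : ∀ {A B n a b} → HasCount A n a → HasCount B n b →
  .{{_ : NonZero b}} → ∀ q → ratio A B n q ⇔ fromℚ ((+ a) / b) q
ratio-correct {A} {B} {n} {a} {suc b} ha hb q = mk⇔ to from
  where
  to : ratio A B n q → q < (+ a) / suc b
  to (k , b′ , hk , hb′ , _ , q<) with refl ← count-unique hb hb′ =
    <-≤-trans q< (/-monoˡ (suc b) (atLeast⇒≤ hk ha))

  from : q < (+ a) / suc b → ratio A B n q
  from q< = a , suc b , count⇒atLeast ha , hb , _ , q<

{-# OPTIONS --safe #-}

-- There are #comb n combinators of size n and #comb (n + 1) ≤ 8 · #comb n, so a
-- combinator of size s counts with weight 8^(-s) against the large subterm next to it.
-- A set P of vectors of combinators is measured by a pair (g , d): g is a lower bound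
-- for Σ 8^(-size) over P, and d one for the lower density of P.  Products behave like
-- derivatives, (g , d) ⊙ (g′ , d′) = (g g′ , g d′ + d g′), and an unconstrained argument
-- has (4 , 1).
--
-- A state is a list of terms with variables, standing for the instances in which all
-- these terms normalise.  Splitting the head variable into S, K and an application and
-- reducing turns a state into three products of other states and of erased variables,
-- since hypotheses without common variables are independent.  For a finite table of
-- states this is a monotone system of polynomial inequalities for the pairs (g , d);
-- iterating it from 0 raises the density of the state {a}, which is 𝒲𝒩, above the claim.
module Submission where

open import Defs
open import Data.Integer using (+_)
open import Data.Rational.Unnormalised using (_/_)

open import Data.Empty using (⊥)
import Data.Integer as ℤ
import Data.Integer.Properties as ℤₚ
open import Data.List as List using (List; []; _∷_; _++_; length)
open import Data.List.Membership.Propositional using (_∈_)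
open import Data.List.Membership.Propositional.Properties
  using (∈-++⁺ˡ; ∈-++⁺ʳ; ∈-++⁻; ∈-map⁺; ∈-map⁻)
open import Data.List.Properties using (length-++; length-map)
open import Data.List.Relation.Unary.All as All using (All; []; _∷_)
import Data.List.Relation.Unary.All.Properties as Allₚ
open import Data.List.Relation.Unary.AllPairs using ([]; _∷_)
open import Data.List.Relation.Unary.Any using (here; there)
open import Data.List.Relation.Unary.Unique.Propositional using (Unique)
import Data.List.Relation.Unary.Unique.Propositional.Properties as Uniqueₚ
open import Data.Maybe as Maybe using (Maybe; just; nothing; _<∣>_; zipWith; from-just)
open import Data.Nat hiding (_/_)
open import Data.Nat.DivMod using (m/n*n≤m) renaming (_/_ to _div_)
open import Data.Nat.Properties
open import Algebra.Properties.CommutativeSemigroup *-commutativeSemigroup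
  using () renaming (x∙yz≈y∙xz to x*[y*z]≡y*[x*z])
open import Algebra.Properties.CommutativeSemigroup +-commutativeSemigroup
  using () renaming (x∙yz≈y∙xz to x+[y+z]≡y+[x+z])
open import Data.Nat.Tactic.RingSolver using (solve-∀)
open import Data.Product using (∃; ∃₂; _×_; _,_; proj₁; proj₂; swap)
import Data.Rational.Unnormalised as ℚᵘ
open import Data.Sum using (inj₁; inj₂)
open import Data.Unit using (⊤; tt)
open import Data.Vec as Vec using (Vec; []; _∷_)
import Data.Vec.Properties as Vecₚ
open import Function using (_∘_; id; mk⇔)
open import Level using (0ℓ)
open import Relation.Binary.Construct.Closure.ReflexiveTransitive
  using (ε; _◅_; _◅◅_; gmap)
open import Relation.Binary.PropositionalEquality
  using (_≡_; refl; sym; trans; cong; cong₂; subst; subst₂; setoid)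
open import Relation.Nullary.Decidable using (dec⇒maybe)
open import Relation.Unary using (Pred; _⊆_)

-- Counting combinators

∥_∥ : ∀ {k} → Vec Comb k → ℕ
∥ [] ∥    = 0
∥ M ∷ v ∥ = size M + ∥ v ∥

glue : ∀ {k} → Vec Comb (2 + k) → Vec Comb (1 + k)
glue (M ∷ N ∷ v) = M · N ∷ v

glue-injective : ∀ {k} {v w : Vec Comb (2 + k)} → glue v ≡ glue w → v ≡ w
glue-injective {v = _ ∷ _ ∷ _} {_ ∷ _ ∷ _} refl = refl

∥glue∥ : ∀ {k} (v : Vec Comb (2 + k)) → ∥ glue v ∥ ≡ suc ∥ v ∥
∥glue∥ (M ∷ N ∷ v) = cong suc (+-assoc (size M) (size N) ∥ v ∥)


split : ∀ {k} → List (Vec Comb k) → List (Vec Comb k) → List (Vec Comb (2 + k)) →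
        List (Vec Comb (1 + k))
split xs ys zs = List.map (S ∷_) xs ++ List.map (K ∷_) ys ++ List.map glue zs

length-split : ∀ {k} (xs ys : List (Vec Comb k)) zs →
  length (split xs ys zs) ≡ length xs + (length ys + length zs)
length-split xs ys zs = trans (length-++ (List.map (S ∷_) xs))
  (cong₂ _+_ (length-map (S ∷_) xs)
    (trans (length-++ (List.map (K ∷_) ys))
      (cong₂ _+_ (length-map (K ∷_) ys) (length-map glue zs))))

module _ {k} {xs ys : List (Vec Comb k)} {zs : List (Vec Comb (2 + k))} where

  split-All : ∀ {P : Vec Comb (1 + k) → Set} → All (P ∘ (S ∷_)) xs →
    All (P ∘ (K ∷_)) ys → All (P ∘ glue) zs → All P (split xs ys zs)
  split-All ps qs rs =
    Allₚ.++⁺ (Allₚ.map⁺ ps) (Allₚ.++⁺ (Allₚ.map⁺ qs) (Allₚ.map⁺ rs))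

  split-unique : Unique xs → Unique ys → Unique zs → Unique (split xs ys zs)
  split-unique us vs ws =
    Uniqueₚ.++⁺ (Uniqueₚ.map⁺ Vecₚ.∷-injectiveʳ us)
      (Uniqueₚ.++⁺ (Uniqueₚ.map⁺ Vecₚ.∷-injectiveʳ vs) (Uniqueₚ.map⁺ glue-injective ws)
        λ (y∈ , z∈) → K≠glue y∈ z∈)
      λ (x∈ , yz∈) → S≠rest x∈ yz∈
    where
    K≠glue : ∀ {v} → v ∈ List.map (K ∷_) ys → v ∈ List.map glue zs → ⊥
    K≠glue y∈ z∈ with ∈-map⁻ (K ∷_) y∈ | ∈-map⁻ glue z∈
    ... | _ , _ , refl | (_ ∷ _ ∷ _) , _ , ()

    S≠rest : ∀ {v} → v ∈ List.map (S ∷_) xs →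
             v ∈ List.map (K ∷_) ys ++ List.map glue zs → ⊥
    S≠rest x∈ yz∈ with ∈-map⁻ (S ∷_) x∈ | ∈-++⁻ (List.map (K ∷_) ys) yz∈
    ... | _ , _ , refl | inj₁ y∈ with ∈-map⁻ (K ∷_) y∈
    ...   | _ , _ , ()
    S≠rest x∈ yz∈ | _ , _ , refl | inj₂ z∈ with ∈-map⁻ glue z∈
    ...   | (_ ∷ _ ∷ _) , _ , ()

-- Whole vectors are enumerated because a head application can be opened into two entries at the
-- cost of one unit of size. The recursion is then a three-term one, lexicographic in `(n , k)`,
-- with no sum over the ways to distribute a size.
forests : ℕ → ∀ k → List (Vec Comb k)
forests zero    zero    = [] ∷ []
forests (suc n) zero    = []
forests zero    (suc k) = split (forests zero k) (forests zero k) []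
forests (suc n) (suc k) =
  split (forests (suc n) k) (forests (suc n) k) (forests n (2 + k))

forests-unique : ∀ n k → Unique (forests n k)
forests-unique zero    zero    = [] ∷ []
forests-unique (suc n) zero    = []
forests-unique zero    (suc k) =
  split-unique (forests-unique zero k) (forests-unique zero k) []
forests-unique (suc n) (suc k) =
  split-unique (forests-unique (suc n) k) (forests-unique (suc n) k)
    (forests-unique n (2 + k))

forests-sound : ∀ n k → All (λ v → ∥ v ∥ ≡ n) (forests n k)
forests-sound zero    zero    = refl ∷ []
forests-sound (suc n) zero    = []
forests-sound zero    (suc k) = split-All (forests-sound zero k) (forests-sound zero k) []
forests-sound (suc n) (suc k) =
  split-All (forests-sound (suc n) k) (forests-sound (suc n) k)
    (All.map (λ {v} e → trans (∥glue∥ v) (cong suc e)) (forests-sound n (2 + k)))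

forests-complete : ∀ n {k} (v : Vec Comb k) → ∥ v ∥ ≡ n → v ∈ forests n k
forests-complete zero    []      refl = here refl
forests-complete zero    (S ∷ v) e    = ∈-++⁺ˡ (∈-map⁺ (S ∷_) (forests-complete zero v e))
forests-complete (suc n) (S ∷ v) e    =
  ∈-++⁺ˡ (∈-map⁺ (S ∷_) (forests-complete (suc n) v e))
forests-complete zero    {suc k} (K ∷ v) e    =
  ∈-++⁺ʳ (List.map (S ∷_) (forests zero k)) (∈-++⁺ˡ (∈-map⁺ (K ∷_) (forests-complete zero v e)))
forests-complete (suc n) {suc k} (K ∷ v) e    =
  ∈-++⁺ʳ (List.map (S ∷_) (forests (suc n) k))
    (∈-++⁺ˡ (∈-map⁺ (K ∷_) (forests-complete (suc n) v e)))
forests-complete (suc n) {suc k} (M · N ∷ v) e =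
  ∈-++⁺ʳ (List.map (S ∷_) (forests (suc n) k))
    (∈-++⁺ʳ (List.map (K ∷_) (forests (suc n) k))
      (∈-map⁺ glue (forests-complete n (M ∷ N ∷ v)
        (suc-injective (trans (sym (∥glue∥ (M ∷ N ∷ v))) e)))))

-- Closed formula and growth of the counts

#forests : ℕ → ℕ → ℕ
#forests n k = length (forests n k)

-- The ballot numbers (k+1)/(2n+k+1) · binom(2n+k+1, n), times 2^(n+k+1) labellings.
IsBallot : (n k b : ℕ) → Set
IsBallot n k b = b * (n ! * (n + suc k) !) ≡ 2 ^ (n + suc k) * (suc k * (n * 2 + k) !)

ballot-zero : ∀ k b → IsBallot 0 k b → IsBallot 0 (suc k) (b + (b + 0))
ballot-zero k b h = trans (lemma₁ b (suc k !) k)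
  (trans (cong (2 * (2 + k) *_) h) (lemma₂ (2 ^ k) (k !) k))
  where
  lemma₁ : ∀ b x k → (b + (b + 0)) * (1 * ((2 + k) * x)) ≡ 2 * (2 + k) * (b * (1 * x))
  lemma₁ = solve-∀
  lemma₂ : ∀ p x k → 2 * (2 + k) * ((2 * p) * (suc k * x)) ≡
                     2 * (2 * p) * ((2 + k) * (suc k * x))
  lemma₂ = solve-∀

ballot-one : ∀ n b → IsBallot n 1 b → IsBallot (suc n) 0 b
ballot-one n b h rewrite +-suc n 1 | +-suc n 0 | +-suc (n * 2) 0 =
  trans (lemma₁ b (n !) (suc (suc (n + 0)) !) n)
    (trans (cong (suc n *_) h) (lemma₂ (2 ^ suc (n + 0)) ((n * 2 + 0) !) n))
  where
  lemma₁ : ∀ b u x n → b * (suc n * u * x) ≡ suc n * (b * (u * x))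
  lemma₁ = solve-∀
  lemma₂ : ∀ p w n → suc n * (2 * p * (2 * (suc (n * 2 + 0) * w))) ≡
                     2 * p * (1 * (suc (suc (n * 2 + 0)) * (suc (n * 2 + 0) * w)))
  lemma₂ = solve-∀

ballot-suc : ∀ n k a b → IsBallot (suc n) k a → IsBallot n (2 + k) b →
  IsBallot (suc n) (suc k) (a + (a + b))
ballot-suc n k a b h₁ h₂
  rewrite +-suc n (2 + k) | +-suc n (1 + k) | +-suc n k
        | +-suc (n * 2) (1 + k) | +-suc (n * 2) k =
  trans (lemma₁ a b (n !) (suc (suc (n + k)) !) n k)
    (trans (cong₂ (λ x y → 2 * (3 + n + k) * x + suc n * y) h₁ h₂)
      (lemma₂ (2 ^ suc (suc (n + k))) (suc (suc (n * 2 + k)) !) n k))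
  where
  lemma₁ : ∀ a b u x n k →
    (a + (a + b)) * (suc n * u * (suc (suc (suc (n + k))) * x)) ≡
    2 * (3 + n + k) * (a * (suc n * u * x)) + suc n * (b * (u * (suc (suc (suc (n + k))) * x)))
  lemma₁ = solve-∀
  lemma₂ : ∀ p w n k →
    2 * (3 + n + k) * (p * (suc k * w)) + suc n * (2 * p * ((3 + k) * w)) ≡
    2 * p * ((2 + k) * (suc (suc (suc (n * 2 + k))) * w))
  lemma₂ = solve-∀

-- Induction along the recursion of `forests`: the S and K branches drop an entry, the application
-- branch trades one unit of size for an entry. The index is one less than the number of entries,
-- since the formula degenerates for the empty vector.
#forests-ballot : ∀ n k → IsBallot n k (#forests n (suc k))
#forests-ballot zero    zero    = refl
#forests-ballot zero    (suc k) =
  subst (IsBallot 0 (suc k)) (sym (length-split (forests 0 (suc k)) (forests 0 (suc k)) []))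
    (ballot-zero k (#forests 0 (suc k)) (#forests-ballot zero k))
#forests-ballot (suc n) zero    =
  subst (IsBallot (suc n) 0) (sym (length-split [] [] (forests n 2)))
    (ballot-one n (#forests n 2) (#forests-ballot n 1))
#forests-ballot (suc n) (suc k) =
  subst (IsBallot (suc n) (suc k))
    (sym (length-split (forests (suc n) (suc k)) (forests (suc n) (suc k)) (forests n (3 + k))))
    (ballot-suc n k (#forests (suc n) (suc k)) (#forests n (3 + k))
      (#forests-ballot (suc n) k) (#forests-ballot n (2 + k)))

#comb : ℕ → ℕ
#comb n = #forests n 1

-- The closed formula gives (n+2) · `#comb (suc n)` = (8n+4) · `#comb n`. The 12 in the chain below
-- is the slack 8(n+2) - (8n+4).
#comb-suc-≤ : ∀ n → #comb (suc n) ≤ 8 * #comb n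
#comb-suc-≤ n = *-cancelʳ-≤ _ _ x {{suc n !* (suc n + 1) !≢0}} (begin
  #comb (suc n) * x                         ≡⟨ #forests-ballot (suc n) 0 ⟩
  2 ^ (suc n + 1) * (1 * (suc n * 2 + 0) !) ≡⟨ lemma₂ (2 ^ (n + 1)) ((n * 2 + 0) !) n ⟩
  2 * (2 + (n * 2 + 0)) * (1 + (n * 2 + 0)) * (2 ^ (n + 1) * (1 * (n * 2 + 0) !))
    ≡⟨ cong (2 * (2 + (n * 2 + 0)) * (1 + (n * 2 + 0)) *_) (#forests-ballot n 0) ⟨
  2 * (2 + (n * 2 + 0)) * (1 + (n * 2 + 0)) * (#comb n * (n ! * (n + 1) !))
    ≤⟨ m≤m+n _ _ ⟩
  2 * (2 + (n * 2 + 0)) * (1 + (n * 2 + 0)) * (#comb n * (n ! * (n + 1) !))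
    + 12 * suc n * (#comb n * (n ! * (n + 1) !))
    ≡⟨ lemma₃ (#comb n) (n !) ((n + 1) !) n ⟩
  8 * #comb n * x ∎)
  where
  open ≤-Reasoning
  x = suc n ! * (suc n + 1) !
  lemma₂ : ∀ p w n → 2 * p * (1 * ((2 + (n * 2 + 0)) * ((1 + (n * 2 + 0)) * w))) ≡
    2 * (2 + (n * 2 + 0)) * (1 + (n * 2 + 0)) * (p * (1 * w))
  lemma₂ = solve-∀
  lemma₃ : ∀ c u y n →
    2 * (2 + (n * 2 + 0)) * (1 + (n * 2 + 0)) * (c * (u * y)) + 12 * suc n * (c * (u * y)) ≡
    8 * c * (suc n * u * (suc (n + 1) * y))
  lemma₃ = solve-∀

#comb≢0 : ∀ n → NonZero (#comb n)
#comb≢0 n = m*n≢0⇒m≢0 (#comb n)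
  {{subst NonZero (sym (#forests-ballot n 0))
    (m*n≢0 (2 ^ (n + 1)) _ {{m^n≢0 2 (n + 1)}} {{m*n≢0 1 _ {{_}} {{(n * 2 + 0) !≢0}}}})}}

-- Weights and densities

-- This is 8^L times the sum of 8^(-∥v∥), scaled to stay in the naturals. Truncated subtraction
-- makes this reading correct only when all sizes are at most `L`, hence the size bounds carried
-- along below.
weight : ∀ {k} → ℕ → List (Vec Comb k) → ℕ
weight L []       = 0
weight L (v ∷ vs) = 8 ^ (L ∸ ∥ v ∥) + weight L vs

weight-++ : ∀ {k} L (xs ys : List (Vec Comb k)) →
  weight L (xs ++ ys) ≡ weight L xs + weight L ys
weight-++ L []       ys = refl
weight-++ L (v ∷ xs) ys =
  trans (cong (_+_ (8 ^ (L ∸ ∥ v ∥))) (weight-++ L xs ys)) (sym (+-assoc (8 ^ (L ∸ ∥ v ∥)) _ _))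

weight-map : ∀ {k l} (f : Vec Comb k → Vec Comb l) L L′ →
  (∀ v → L′ ∸ ∥ f v ∥ ≡ L ∸ ∥ v ∥) → ∀ xs → weight L′ (List.map f xs) ≡ weight L xs
weight-map f L L′ e []       = refl
weight-map f L L′ e (v ∷ xs) = cong₂ _+_ (cong (8 ^_) (e v)) (weight-map f L L′ e xs)

weight-split : ∀ {k} L (xs ys : List (Vec Comb k)) zs →
  weight (suc L) (split xs ys zs) ≡ weight (suc L) xs + (weight (suc L) ys + weight L zs)
weight-split L xs ys zs = trans (weight-++ (suc L) (List.map (S ∷_) xs) _)
  (cong₂ _+_ (weight-map (S ∷_) (suc L) (suc L) (λ _ → refl) xs)
    (trans (weight-++ (suc L) (List.map (K ∷_) ys) _)
      (cong₂ _+_ (weight-map (K ∷_) (suc L) (suc L) (λ _ → refl) ys)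
        (weight-map glue L (suc L) (λ v → cong (suc L ∸_) (∥glue∥ v)) zs))))

weight-raise : ∀ {k} d L {xs : List (Vec Comb k)} → All (λ v → ∥ v ∥ ≤ L) xs →
  weight (d + L) xs ≡ 8 ^ d * weight L xs
weight-raise d L []               = sym (*-zeroʳ (8 ^ d))
weight-raise d L {v ∷ xs} (p ∷ ps) = trans
  (cong₂ _+_ (trans (cong (8 ^_) (+-∸-assoc d p)) (^-distribˡ-+-* 8 d _)) (weight-raise d L ps))
  (sym (*-distribˡ-+ (8 ^ d) _ (weight L xs)))

-- P contains a finite set of vectors v with Σ 8^(-∥v∥) ≥ p/q.
record Heavy {k} (P : Pred (Vec Comb k) 0ℓ) (p q : ℕ) : Set where
  field
    bound  : ℕ
    elems  : List (Vec Comb k)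
    unique : Unique elems
    sound  : All (λ v → P v × ∥ v ∥ ≤ bound) elems
    heavy  : p * 8 ^ bound ≤ q * weight bound elems

  heavy-raise : ∀ {L} → bound ≤ L → p * 8 ^ L ≤ q * weight L elems
  heavy-raise {L} b≤L = begin
    p * 8 ^ L                        ≡⟨ cong (λ n → p * 8 ^ n) (m∸n+n≡m b≤L) ⟨
    p * 8 ^ (d + bound)              ≡⟨ cong (p *_) (^-distribˡ-+-* 8 d bound) ⟩
    p * (8 ^ d * 8 ^ bound)          ≡⟨ x*[y*z]≡y*[x*z] p (8 ^ d) (8 ^ bound) ⟩
    8 ^ d * (p * 8 ^ bound)          ≤⟨ *-monoʳ-≤ (8 ^ d) heavy ⟩
    8 ^ d * (q * weight bound elems) ≡⟨ x*[y*z]≡y*[x*z] (8 ^ d) q (weight bound elems) ⟩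
    q * (8 ^ d * weight bound elems) ≡⟨ cong (q *_) (weight-raise d bound (All.map proj₂ sound)) ⟨
    q * weight (d + bound) elems     ≡⟨ cong (λ n → q * weight n elems) (m∸n+n≡m b≤L) ⟩
    q * weight L elems               ∎
    where
    open ≤-Reasoning
    d = L ∸ bound

-- For every `k` the comparison is with the number of single combinators, not of k-vectors, so p/q
-- may exceed 1. This normalisation is what makes the product rule look like the Leibniz rule.
record Dense {k} (P : Pred (Vec Comb k) 0ℓ) (p q : ℕ) : Set where
  field
    threshold : ℕ
    dense : ∀ n → threshold ≤ n → ∃ λ xs → Unique xs ×
      All (λ v → P v × ∥ v ∥ ≡ n) xs × p * #comb n ≤ q * length xs


rescale-≤ : ∀ p q p′ q′ x y .{{_ : NonZero q}} →
  p′ * q ≤ p * q′ → p * x ≤ q * y → p′ * x ≤ q′ * y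
rescale-≤ p q p′ q′ x y h l = *-cancelˡ-≤ q (begin
  q * (p′ * x)  ≡⟨ lemma q p′ x ⟩
  p′ * q * x    ≤⟨ *-monoˡ-≤ x h ⟩
  p * q′ * x    ≡⟨ lemma q′ p x ⟨
  q′ * (p * x)  ≤⟨ *-monoʳ-≤ q′ l ⟩
  q′ * (q * y)  ≡⟨ x*[y*z]≡y*[x*z] q′ q y ⟩
  q * (q′ * y)  ∎)
  where
  open ≤-Reasoning
  lemma : ∀ x y z → x * (y * z) ≡ y * x * z
  lemma = solve-∀

module _ {k} {P : Pred (Vec Comb k) 0ℓ} where

  Heavy-rescale : ∀ {p q p′ q′} .{{_ : NonZero q}} → p′ * q ≤ p * q′ → Heavy P p q → Heavy P p′ q′
  Heavy-rescale {p} {q} {p′} {q′} h H = record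
    { Heavy H
    ; heavy = rescale-≤ p q p′ q′ (8 ^ bound) (weight bound elems) h heavy }
    where open Heavy H

  Dense-rescale : ∀ {p q p′ q′} .{{_ : NonZero q}} → p′ * q ≤ p * q′ → Dense P p q → Dense P p′ q′
  Dense-rescale {p} {q} {p′} {q′} h D = record
    { threshold = threshold
    ; dense = λ n t≤n → let xs , u , a , l = dense n t≤n in
        xs , u , a , rescale-≤ p q p′ q′ (#comb n) (length xs) h l }
    where open Dense D

  Heavy-mono : ∀ {Q : Pred (Vec Comb k) 0ℓ} {p q} → P ⊆ Q → Heavy P p q → Heavy Q p q
  Heavy-mono P⊆Q H = record { Heavy H ; sound = All.map (λ (a , b) → P⊆Q a , b) (Heavy.sound H) }

  Dense-mono : ∀ {Q : Pred (Vec Comb k) 0ℓ} {p q} → P ⊆ Q → Dense P p q → Dense Q p q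
  Dense-mono P⊆Q D = record
    { threshold = threshold
    ; dense = λ n t≤n → let xs , u , a , l = dense n t≤n in
        xs , u , All.map (λ (b , c) → P⊆Q b , c) a , l }
    where open Dense D

  module _ {l} {Q : Pred (Vec Comb l) 0ℓ} {p q : ℕ} (f : Vec Comb k → Vec Comb l)
    (f-injective : ∀ {v w} → f v ≡ f w → v ≡ w) (∥f∥ : ∀ v → ∥ f v ∥ ≡ ∥ v ∥)
    (P⇒Q : ∀ {v} → P v → Q (f v)) where

    Heavy-map : Heavy P p q → Heavy Q p q
    Heavy-map H = record
      { bound  = bound
      ; elems  = List.map f elems
      ; unique = Uniqueₚ.map⁺ f-injective unique
      ; sound  = Allₚ.map⁺ (All.map (λ {v} (a , b) →
                   P⇒Q a , subst (_≤ bound) (sym (∥f∥ v)) b) sound)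
      ; heavy  = subst (λ w → p * 8 ^ bound ≤ q * w)
                   (sym (weight-map f bound bound (λ v → cong (bound ∸_) (∥f∥ v)) elems)) heavy }
      where open Heavy H

    Dense-map : Dense P p q → Dense Q p q
    Dense-map D = record
      { threshold = threshold
      ; dense = λ n t≤n → let xs , u , a , h = dense n t≤n in
          List.map f xs , Uniqueₚ.map⁺ f-injective u ,
          Allₚ.map⁺ (All.map (λ {v} (b , c) → P⇒Q b , trans (∥f∥ v) c) a) ,
          subst (λ w → p * #comb n ≤ q * w) (sym (length-map f xs)) h }
      where open Dense D

Heavy-zero : ∀ {k} (P : Pred (Vec Comb k) 0ℓ) q → Heavy P 0 q
Heavy-zero P q = record { bound = 0 ; elems = [] ; unique = [] ; sound = [] ; heavy = z≤n }

Dense-zero : ∀ {k} (P : Pred (Vec Comb k) 0ℓ) q → Dense P 0 q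
Dense-zero P q = record { threshold = 0 ; dense = λ n _ → [] , [] , [] , z≤n }

module _ {k} {P : Pred (Vec Comb (1 + k)) 0ℓ} {a b c c′ q : ℕ} (8c′≤c : 8 * c′ ≤ c) where

  -- The primitives have size 0 and leave weights unchanged, while `glue` adds one application and
  -- divides them by 8. Any integer `c′` below c/8 is allowed, so that rounding down stays sound.
  Heavy-split : Heavy (P ∘ (S ∷_)) a q → Heavy (P ∘ (K ∷_)) b q → Heavy (P ∘ glue) c q →
    Heavy P (a + (b + c′)) q
  Heavy-split HS HK HG = record
    { bound  = suc L
    ; elems  = split (elems HS) (elems HK) (elems HG)
    ; unique = split-unique (unique HS) (unique HK) (unique HG)
    ; sound  = split-All {P = λ v → P v × ∥ v ∥ ≤ suc L}
        (All.map (λ (p , l) → p , ≤-trans l S≤) (sound HS))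
        (All.map (λ (p , l) → p , ≤-trans l K≤) (sound HK))
        (All.map (λ {v} (p , l) →
          p , subst (_≤ suc L) (sym (∥glue∥ v)) (s≤s (≤-trans l G≤))) (sound HG))
    ; heavy = begin
        (a + (b + c′)) * (8 * 8 ^ L)
          ≡⟨ lemma₁ a b c′ (8 ^ L) ⟩
        a * (8 * 8 ^ L) + (b * (8 * 8 ^ L) + 8 * c′ * 8 ^ L)
          ≤⟨ +-mono-≤ (heavy-raise HS S≤) (+-mono-≤ (heavy-raise HK K≤)
               (≤-trans (*-monoˡ-≤ (8 ^ L) 8c′≤c) (heavy-raise HG G≤))) ⟩
        q * weight (suc L) (elems HS) + (q * weight (suc L) (elems HK) + q * weight L (elems HG))
          ≡⟨ lemma₂ q (weight (suc L) (elems HS)) _ _ ⟩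
        q * (weight (suc L) (elems HS) + (weight (suc L) (elems HK) + weight L (elems HG)))
          ≡⟨ cong (q *_) (weight-split L (elems HS) (elems HK) (elems HG)) ⟨
        q * weight (suc L) (split (elems HS) (elems HK) (elems HG)) ∎ }
    where
    open Heavy
    open ≤-Reasoning
    -- The sum serves as a common size bound, and `suc L` leaves room for the application made by
    -- `glue`.
    L = bound HS + (bound HK + bound HG)
    S≤ : bound HS ≤ suc L
    S≤ = m≤n⇒m≤1+n (m≤m+n _ _)
    K≤ : bound HK ≤ suc L
    K≤ = m≤n⇒m≤1+n (m≤n⇒m≤o+n (bound HS) (m≤m+n _ _))
    G≤ : bound HG ≤ L
    G≤ = m≤n⇒m≤o+n (bound HS) (m≤n+m _ _)
    lemma₁ : ∀ a b c x → (a + (b + c)) * (8 * x) ≡ a * (8 * x) + (b * (8 * x) + 8 * c * x)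
    lemma₁ = solve-∀
    lemma₂ : ∀ q x y z → q * x + (q * y + q * z) ≡ q * (x + (y + z))
    lemma₂ = solve-∀

  -- Vectors of size n+1 in the application branch come from vectors of size n. By `#comb-suc-≤`
  -- this shift costs at most the factor 8.
  Dense-split : Dense (P ∘ (S ∷_)) a q → Dense (P ∘ (K ∷_)) b q → Dense (P ∘ glue) c q →
    Dense P (a + (b + c′)) q
  Dense-split DS DK DG = record { threshold = suc L ; dense = dns }
    where
    open Dense
    open ≤-Reasoning
    L = threshold DS + (threshold DK + threshold DG)
    S≤ : threshold DS ≤ suc L
    S≤ = m≤n⇒m≤1+n (m≤m+n _ _)
    K≤ : threshold DK ≤ suc L
    K≤ = m≤n⇒m≤1+n (m≤n⇒m≤o+n (threshold DS) (m≤m+n _ _))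
    G≤ : threshold DG ≤ L
    G≤ = m≤n⇒m≤o+n (threshold DS) (m≤n+m _ _)
    lemma₁ : ∀ a b c x → (a + (b + c)) * x ≡ a * x + (b * x + c * x)
    lemma₁ = solve-∀
    lemma₂ : ∀ q x y z → q * x + (q * y + q * z) ≡ q * (x + (y + z))
    lemma₂ = solve-∀
    lemma₃ : ∀ c x → c * (8 * x) ≡ 8 * c * x
    lemma₃ = solve-∀

    dns : ∀ n → suc L ≤ n → ∃ λ xs → Unique xs ×
      All (λ v → P v × ∥ v ∥ ≡ n) xs × (a + (b + c′)) * #comb n ≤ q * length xs
    dns (suc n) L<n@(s≤s L≤n)
      with xs , u , s , h ← dense DS (suc n) (≤-trans S≤ L<n)
         | ys , v , t , i ← dense DK (suc n) (≤-trans K≤ L<n)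
         | zs , w , r , j ← dense DG n (≤-trans G≤ L≤n)
      = split xs ys zs , split-unique u v w ,
        split-All {P = λ v → P v × ∥ v ∥ ≡ suc n} s t
          (All.map (λ {v} (p , e) → p , trans (∥glue∥ v) (cong suc e)) r) ,
        (begin
          (a + (b + c′)) * #comb (suc n)
            ≡⟨ lemma₁ a b c′ (#comb (suc n)) ⟩
          a * #comb (suc n) + (b * #comb (suc n) + c′ * #comb (suc n))
            ≤⟨ +-mono-≤ h (+-mono-≤ i (≤-trans (*-monoʳ-≤ c′ (#comb-suc-≤ n)) (begin
                c′ * (8 * #comb n) ≡⟨ lemma₃ c′ (#comb n) ⟩
                8 * c′ * #comb n   ≤⟨ *-monoˡ-≤ (#comb n) 8c′≤c ⟩
                c * #comb n        ≤⟨ j ⟩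
                q * length zs      ∎))) ⟩
          q * length xs + (q * length ys + q * length zs)
            ≡⟨ lemma₂ q (length xs) _ _ ⟩
          q * (length xs + (length ys + length zs))
            ≡⟨ cong (q *_) (length-split xs ys zs) ⟨
          q * length (split xs ys zs) ∎)

-- Products of measured sets

_⊗_ : ∀ {k l} → Pred (Vec Comb k) 0ℓ → Pred (Vec Comb l) 0ℓ → Pred (Vec Comb (k + l)) 0ℓ
(P ⊗ Q) w = ∃₂ λ u v → w ≡ u Vec.++ v × P u × Q v

∥++∥ : ∀ {k l} (u : Vec Comb k) (v : Vec Comb l) → ∥ u Vec.++ v ∥ ≡ ∥ u ∥ + ∥ v ∥
∥++∥ []      v = refl
∥++∥ (M ∷ u) v = trans (cong (_+_ (size M)) (∥++∥ u v)) (sym (+-assoc (size M) ∥ u ∥ ∥ v ∥))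

weight-product : ∀ {k l} L L′ {us : List (Vec Comb k)} {vs : List (Vec Comb l)} →
  All (λ u → ∥ u ∥ ≤ L) us → All (λ v → ∥ v ∥ ≤ L′) vs →
  weight (L + L′) (List.cartesianProductWith Vec._++_ us vs) ≡ weight L us * weight L′ vs
weight-product L L′ [] _ = refl
weight-product L L′ {u ∷ us} {vs} (p ∷ ps) qs = trans
  (weight-++ (L + L′) (List.map (u Vec.++_) vs) _)
  (trans (cong₂ _+_ (row qs) (weight-product L L′ ps qs))
    (sym (*-distribʳ-+ (weight L′ vs) (8 ^ (L ∸ ∥ u ∥)) _)))
  where
  ∸-+ : ∀ a b c d → b ≤ a → d ≤ c → (a + c) ∸ (b + d) ≡ (a ∸ b) + (c ∸ d)
  ∸-+ a zero    c d _ d≤c         = +-∸-assoc a d≤c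
  ∸-+ (suc a) (suc b) c d (s≤s b≤a) d≤c = ∸-+ a b c d b≤a d≤c

  row : ∀ {vs} → All (λ v → ∥ v ∥ ≤ L′) vs →
    weight (L + L′) (List.map (u Vec.++_) vs) ≡ 8 ^ (L ∸ ∥ u ∥) * weight L′ vs
  row [] = sym (*-zeroʳ (8 ^ (L ∸ ∥ u ∥)))
  row {v ∷ vs} (q ∷ qs) = trans
    (cong₂ _+_
      (trans (cong (8 ^_) (trans (cong (L + L′ ∸_) (∥++∥ u v)) (∸-+ L (∥ u ∥) L′ (∥ v ∥) p q)))
        (^-distribˡ-+-* 8 (L ∸ ∥ u ∥) (L′ ∸ ∥ v ∥)))
      (row qs))
    (sym (*-distribˡ-+ (8 ^ (L ∸ ∥ u ∥)) _ (weight L′ vs)))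

#comb-+-≤ : ∀ d n → #comb (d + n) ≤ 8 ^ d * #comb n
#comb-+-≤ zero    n = ≤-reflexive (sym (*-identityˡ (#comb n)))
#comb-+-≤ (suc d) n = begin
  #comb (suc d + n)       ≤⟨ #comb-suc-≤ (d + n) ⟩
  8 * #comb (d + n)       ≤⟨ *-monoʳ-≤ 8 (#comb-+-≤ d n) ⟩
  8 * (8 ^ d * #comb n)   ≡⟨ *-assoc 8 (8 ^ d) (#comb n) ⟨
  8 ^ suc d * #comb n     ∎
  where open ≤-Reasoning

module _ {k l m} (f : Vec Comb k → Vec Comb l → Vec Comb m)
  (f-injective : ∀ {u v u′ v′} → f u v ≡ f u′ v′ → u ≡ u′ × v ≡ v′)
  {Q : Pred (Vec Comb l) 0ℓ} {b q : ℕ} (D : Dense Q b q) (L : ℕ) where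

  open Dense D

  -- Each of the finitely many small `u` is joined to the large `v` of size n - ∥u∥, of which there
  -- are at least (b/q) · 8^(-∥u∥) · `#comb n`. Summing over `us` produces its weight. The joining
  -- map `f` is abstract so that the small part can stand on either side.
  attach : ∀ n → L + threshold ≤ n → ∀ {us} → Unique us → All (λ u → ∥ u ∥ ≤ L) us →
    ∃ λ ws → Unique ws ×
      All (λ w → ∃₂ λ u v → w ≡ f u v × u ∈ us × Q v × ∥ u ∥ + ∥ v ∥ ≡ n) ws ×
      weight L us * (b * #comb n) ≤ 8 ^ L * (q * length ws)
  attach n L+t≤n [] [] = [] , [] , [] , z≤n
  attach n L+t≤n {u ∷ us} (u∉us ∷ uniq) (u≤L ∷ us≤L)
    with vs , vs! , vs-sound , vs-dense ← dense (n ∸ ∥ u ∥)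
           (m+n≤o⇒m≤o∸n threshold (≤-trans (≤-reflexive (+-comm threshold ∥ u ∥))
             (≤-trans (+-monoˡ-≤ threshold u≤L) L+t≤n)))
       | ws , ws! , ws-sound , ws-dense ← attach n L+t≤n uniq us≤L
    = List.map (f u) vs ++ ws
    , Uniqueₚ.++⁺ (Uniqueₚ.map⁺ (proj₂ ∘ f-injective) vs!) ws! disjoint
    , Allₚ.++⁺
        (Allₚ.map⁺ (All.map (λ {v} (p , e) → u , v , refl , here refl , p ,
          trans (cong (_+_ ∥ u ∥) e) (m+[n∸m]≡n u≤n)) vs-sound))
        (All.map (λ (u , v , e , u∈ , r) → u , v , e , there u∈ , r) ws-sound)
    , (begin
        (8 ^ (L ∸ ∥ u ∥) + weight L us) * (b * #comb n)
          ≡⟨ *-distribʳ-+ (b * #comb n) (8 ^ (L ∸ ∥ u ∥)) _ ⟩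
        8 ^ (L ∸ ∥ u ∥) * (b * #comb n) + weight L us * (b * #comb n)
          ≤⟨ +-mono-≤ (begin
            8 ^ (L ∸ ∥ u ∥) * (b * #comb n)
              ≡⟨ cong (λ i → 8 ^ (L ∸ ∥ u ∥) * (b * #comb i)) (m+[n∸m]≡n u≤n) ⟨
            8 ^ (L ∸ ∥ u ∥) * (b * #comb (∥ u ∥ + (n ∸ ∥ u ∥)))
              ≤⟨ *-monoʳ-≤ (8 ^ (L ∸ ∥ u ∥)) (*-monoʳ-≤ b (#comb-+-≤ ∥ u ∥ (n ∸ ∥ u ∥))) ⟩
            8 ^ (L ∸ ∥ u ∥) * (b * (8 ^ ∥ u ∥ * #comb (n ∸ ∥ u ∥)))
              ≡⟨ regroup (8 ^ (L ∸ ∥ u ∥)) b (8 ^ ∥ u ∥) _ ⟩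
            8 ^ (L ∸ ∥ u ∥) * 8 ^ ∥ u ∥ * (b * #comb (n ∸ ∥ u ∥))
              ≡⟨ cong (_* (b * #comb (n ∸ ∥ u ∥))) (trans
                   (sym (^-distribˡ-+-* 8 (L ∸ ∥ u ∥) ∥ u ∥)) (cong (8 ^_) (m∸n+n≡m u≤L))) ⟩
            8 ^ L * (b * #comb (n ∸ ∥ u ∥))
              ≤⟨ *-monoʳ-≤ (8 ^ L) vs-dense ⟩
            8 ^ L * (q * length vs) ∎) ws-dense ⟩
        8 ^ L * (q * length vs) + 8 ^ L * (q * length ws)
          ≡⟨ distrib (8 ^ L) q (length vs) (length ws) ⟩
        8 ^ L * (q * (length vs + length ws))
          ≡⟨ cong (λ i → 8 ^ L * (q * (i + length ws))) (length-map (f u) vs) ⟨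
        8 ^ L * (q * (length (List.map (f u) vs) + length ws))
          ≡⟨ cong (λ i → 8 ^ L * (q * i)) (length-++ (List.map (f u) vs)) ⟨
        8 ^ L * (q * length (List.map (f u) vs ++ ws)) ∎)
    where
    open ≤-Reasoning
    u≤n : ∥ u ∥ ≤ n
    u≤n = ≤-trans u≤L (≤-trans (m≤m+n L threshold) L+t≤n)

    disjoint : ∀ {w} → w ∈ List.map (f u) vs × w ∈ ws → ⊥
    disjoint (w∈₁ , w∈₂) with ∈-map⁻ (f u) w∈₁ | All.lookup ws-sound w∈₂
    ... | _ , _ , refl | u′ , v , e , u′∈ , _ =
      All.lookup u∉us u′∈ (proj₁ (f-injective e))

    regroup : ∀ x y z w → x * (y * (z * w)) ≡ x * z * (y * w)
    regroup = solve-∀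
    distrib : ∀ x q y z → x * (q * y) + x * (q * z) ≡ x * (q * (y + z))
    distrib = solve-∀

++-injective : ∀ {k l} {u u′ : Vec Comb k} {v v′ : Vec Comb l} →
  u Vec.++ v ≡ u′ Vec.++ v′ → u ≡ u′ × v ≡ v′
++-injective {u = u} {u′} = Vecₚ.++-injective u u′

module _ {k l} {P : Pred (Vec Comb k) 0ℓ} {Q : Pred (Vec Comb l) 0ℓ} {a b q : ℕ}
  (HP : Heavy P a q) (HQ : Heavy Q b q) where

  open Heavy

  Heavy-⊗ : Heavy (P ⊗ Q) (a * b) (q * q)
  Heavy-⊗ = record
    { bound  = bound HP + bound HQ
    ; elems  = List.cartesianProductWith Vec._++_ (elems HP) (elems HQ)
    ; unique = Uniqueₚ.cartesianProductWith⁺ Vec._++_ ++-injective (unique HP) (unique HQ)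
    ; sound  = Allₚ.cartesianProductWith⁺ (setoid _) (setoid _) Vec._++_ (elems HP) (elems HQ)
        λ {u} {v} u∈ v∈ →
          let p , u≤ = All.lookup (sound HP) u∈ ; r , v≤ = All.lookup (sound HQ) v∈ in
          (u , v , refl , p , r) , subst (_≤ _) (sym (∥++∥ u v)) (+-mono-≤ u≤ v≤)
    ; heavy  = begin
        a * b * 8 ^ (bound HP + bound HQ)
          ≡⟨ cong (a * b *_) (^-distribˡ-+-* 8 (bound HP) (bound HQ)) ⟩
        a * b * (8 ^ bound HP * 8 ^ bound HQ)
          ≡⟨ regroup a b (8 ^ bound HP) (8 ^ bound HQ) ⟩
        (a * 8 ^ bound HP) * (b * 8 ^ bound HQ)
          ≤⟨ *-mono-≤ (heavy HP) (heavy HQ) ⟩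
        (q * weight (bound HP) (elems HP)) * (q * weight (bound HQ) (elems HQ))
          ≡⟨ regroup q q (weight (bound HP) (elems HP)) (weight (bound HQ) (elems HQ)) ⟨
        q * q * (weight (bound HP) (elems HP) * weight (bound HQ) (elems HQ))
          ≡⟨ cong (q * q *_) (weight-product (bound HP) (bound HQ)
               (All.map proj₂ (sound HP)) (All.map proj₂ (sound HQ))) ⟨
        q * q * weight (bound HP + bound HQ)
          (List.cartesianProductWith Vec._++_ (elems HP) (elems HQ)) ∎ }
    where
    open ≤-Reasoning
    regroup : ∀ x y z w → x * y * (z * w) ≡ (x * z) * (y * w)
    regroup = solve-∀

  -- Either component can be the large one.  No element is counted twice once its size
  -- exceeds the sum of the two bounds.
  Dense-⊗ : ∀ {a′ b′} → Dense P a′ q → Dense Q b′ q → Dense (P ⊗ Q) (a * b′ + a′ * b) (q * q)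
  Dense-⊗ {a′} {b′} DP DQ = record { threshold = suc (L + L′ + (t + t′)) ; dense = dns }
    where
    open Dense
    open ≤-Reasoning
    L = bound HP
    L′ = bound HQ
    t = threshold DP
    t′ = threshold DQ

    L+t′≤ : L + t′ ≤ suc (L + L′ + (t + t′))
    L+t′≤ = m≤n⇒m≤1+n (+-mono-≤ (m≤m+n L L′) (m≤n+m t′ t))
    L′+t≤ : L′ + t ≤ suc (L + L′ + (t + t′))
    L′+t≤ = m≤n⇒m≤1+n (+-mono-≤ (m≤n+m L′ L) (m≤m+n t t′))

    -- One summand of the Leibniz rule: the bound x/q ≤ w/M from `Heavy` is inserted into the
    -- estimate of `attach`, and the scale M, a power of 8, cancels.
    half : ∀ x y M w c N → x * M ≤ q * w → w * (y * c) ≤ M * (q * N) → .{{_ : NonZero M}} →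
      x * y * c ≤ q * q * N
    half x y M w c N h i = *-cancelˡ-≤ M (begin
      M * (x * y * c)     ≡⟨ lemma₁ M x y c ⟩
      x * M * (y * c)     ≤⟨ *-monoˡ-≤ (y * c) h ⟩
      q * w * (y * c)     ≡⟨ *-assoc q w (y * c) ⟩
      q * (w * (y * c))   ≤⟨ *-monoʳ-≤ q i ⟩
      q * (M * (q * N))   ≡⟨ lemma₂ q M N ⟩
      M * (q * q * N)     ∎)
      where
      lemma₁ : ∀ M x y c → M * (x * y * c) ≡ x * M * (y * c)
      lemma₁ = solve-∀
      lemma₂ : ∀ q M N → q * (M * (q * N)) ≡ M * (q * q * N)
      lemma₂ = solve-∀

    dns : ∀ n → suc (L + L′ + (t + t′)) ≤ n → ∃ λ ws → Unique ws ×
      All (λ w → (P ⊗ Q) w × ∥ w ∥ ≡ n) ws × (a * b′ + a′ * b) * #comb n ≤ q * q * length ws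
    dns n N≤n
      with xs , xs! , xs-sound , xs-dense ← attach Vec._++_ ++-injective DQ L n
             (≤-trans L+t′≤ N≤n) (unique HP) (All.map proj₂ (sound HP))
         | ys , ys! , ys-sound , ys-dense ←
             attach (λ v u → u Vec.++ v) (swap ∘ ++-injective) DP L′ n
             (≤-trans L′+t≤ N≤n) (unique HQ) (All.map proj₂ (sound HQ))
      = xs ++ ys
      , Uniqueₚ.++⁺ xs! ys! disjoint
      , Allₚ.++⁺
          (All.map (λ (u , v , e , u∈ , r , s) →
            (u , v , e , proj₁ (All.lookup (sound HP) u∈) , r) ,
            trans (cong ∥_∥ e) (trans (∥++∥ u v) s)) xs-sound)
          (All.map (λ (v , u , e , v∈ , r , s) →
            (u , v , e , r , proj₁ (All.lookup (sound HQ) v∈)) ,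
            trans (cong ∥_∥ e) (trans (∥++∥ u v) (trans (+-comm ∥ u ∥ ∥ v ∥) s))) ys-sound)
      , (begin
          (a * b′ + a′ * b) * #comb n
            ≡⟨ lemma₁ a b′ a′ b (#comb n) ⟩
          a * b′ * #comb n + b * a′ * #comb n
            ≤⟨ +-mono-≤
                 (half a b′ (8 ^ L) _ (#comb n) _ (heavy HP) xs-dense {{m^n≢0 8 L}})
                 (half b a′ (8 ^ L′) _ (#comb n) _ (heavy HQ) ys-dense {{m^n≢0 8 L′}}) ⟩
          q * q * length xs + q * q * length ys
            ≡⟨ *-distribˡ-+ (q * q) (length xs) (length ys) ⟨
          q * q * (length xs + length ys)
            ≡⟨ cong (q * q *_) (length-++ xs) ⟨
          q * q * length (xs ++ ys) ∎)
      where
      lemma₁ : ∀ a b′ a′ b c → (a * b′ + a′ * b) * c ≡ a * b′ * c + b * a′ * c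
      lemma₁ = solve-∀

      disjoint : ∀ {w} → w ∈ xs × w ∈ ys → ⊥
      disjoint (w∈₁ , w∈₂) with All.lookup xs-sound w∈₁ | All.lookup ys-sound w∈₂
      ... | u , v , refl , u∈ , _ | v′ , u′ , e , v′∈ , _ , s
        with refl , refl ← ++-injective {u = u} {u′} {v} {v′} e =
        n≮n n (begin-strict
          n                   ≡⟨ s ⟨
          ∥ v ∥ + ∥ u ∥       ≤⟨ +-mono-≤ (proj₂ (All.lookup (sound HQ) v′∈))
                                   (proj₂ (All.lookup (sound HP) u∈)) ⟩
          L′ + L              ≡⟨ +-comm L′ L ⟩
          L + L′              ≤⟨ m≤m+n _ _ ⟩
          L + L′ + (t + t′)   <⟨ N≤n ⟩
          n                   ∎)

-- Symbolic normalisation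

𝒲𝒩-⟶ : ∀ {M N} → M ⟶ N → 𝒲𝒩 N → 𝒲𝒩 M
𝒲𝒩-⟶ r (N′ , nf , rs) = N′ , nf , r ◅ rs

𝒲𝒩-S : 𝒲𝒩 S
𝒲𝒩-S = S , (λ ()) , ε

𝒲𝒩-K : 𝒲𝒩 K
𝒲𝒩-K = K , (λ ()) , ε

-- With at most two arguments for S and one for K there is no redex at the root, so the normal forms
-- of the arguments assemble to a normal form.
𝒲𝒩-S· : ∀ {M} → 𝒲𝒩 M → 𝒲𝒩 (S · M)
𝒲𝒩-S· (M′ , nf , rs) = S · M′ , (λ { (_ , appʳ r) → nf (_ , r) }) , gmap (S ·_) appʳ rs

𝒲𝒩-K· : ∀ {M} → 𝒲𝒩 M → 𝒲𝒩 (K · M)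
𝒲𝒩-K· (M′ , nf , rs) = K · M′ , (λ { (_ , appʳ r) → nf (_ , r) }) , gmap (K ·_) appʳ rs

𝒲𝒩-S·· : ∀ {M N} → 𝒲𝒩 M → 𝒲𝒩 N → 𝒲𝒩 (S · M · N)
𝒲𝒩-S·· {M} {N} (M′ , nfM , rs) (N′ , nfN , ss) =
  S · M′ · N′ , nf , gmap (λ X → S · X · N) (appˡ ∘ appʳ) rs ◅◅ gmap (S · M′ ·_) appʳ ss
  where
  nf : ∃ (S · M′ · N′ ⟶_) → ⊥
  nf (_ , appˡ (appʳ r)) = nfM (_ , r)
  nf (_ , appʳ r)        = nfN (_ , r)

infixl 7 _·_
data Term : Set where
  S K : Term
  var : ℕ → Term
  _·_ : Term → Term → Term

-- Out-of-range variables denote S.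
at : ∀ {A : Set} {k} → A → Vec A k → ℕ → A
at d []      i       = d
at d (x ∷ v) zero    = x
at d (x ∷ v) (suc i) = at d v i

at-map : ∀ {A B : Set} {k} (f : A → B) d (v : Vec A k) i → f (at d v i) ≡ at (f d) (Vec.map f v) i
at-map f d []      i       = refl
at-map f d (x ∷ v) zero    = refl
at-map f d (x ∷ v) (suc i) = at-map f d v i

⟦_⟧ : Term → ∀ {k} → Vec Comb k → Comb
⟦ S ⟧     v = S
⟦ K ⟧     v = K
⟦ var i ⟧ v = at S v i
⟦ t · u ⟧ v = ⟦ t ⟧ v · ⟦ u ⟧ v

_[_] : Term → ∀ {k} → Vec Term k → Term
S       [ σ ] = S
K       [ σ ] = K
var i   [ σ ] = at S σ i
(t · u) [ σ ] = t [ σ ] · u [ σ ]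

eval : ∀ {k l} → Vec Comb l → Vec Term k → Vec Comb k
eval v = Vec.map (λ t → ⟦ t ⟧ v)

⟦⟧-[] : ∀ t {k l} (σ : Vec Term k) (v : Vec Comb l) → ⟦ t [ σ ] ⟧ v ≡ ⟦ t ⟧ (eval v σ)
⟦⟧-[] S       σ v = refl
⟦⟧-[] K       σ v = refl
⟦⟧-[] (var i) σ v = at-map (λ t → ⟦ t ⟧ v) S σ i
⟦⟧-[] (t · u) σ v = cong₂ _·_ (⟦⟧-[] t σ v) (⟦⟧-[] u σ v)

Normalises : List Term → ∀ {k} → Pred (Vec Comb k) 0ℓ
Normalises ts v = All (λ t → 𝒲𝒩 (⟦ t ⟧ v)) ts

instantiate : ∀ {k} → Vec Term k → List Term → List Term
instantiate σ = List.map (_[ σ ])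

module _ {k l} (σ : Vec Term k) {v : Vec Comb l} where

  Normalises-instantiate⁻ : ∀ {ts} → Normalises (instantiate σ ts) v → Normalises ts (eval v σ)
  Normalises-instantiate⁻ {[]}     []       = []
  Normalises-instantiate⁻ {t ∷ ts} (n ∷ ns) =
    subst 𝒲𝒩 (⟦⟧-[] t σ v) n ∷ Normalises-instantiate⁻ ns

  Normalises-instantiate⁺ : ∀ {ts} → Normalises ts (eval v σ) → Normalises (instantiate σ ts) v
  Normalises-instantiate⁺ {[]}     []       = []
  Normalises-instantiate⁺ {t ∷ ts} (n ∷ ns) =
    subst 𝒲𝒩 (sym (⟦⟧-[] t σ v)) n ∷ Normalises-instantiate⁺ ns

-- Deriving normalisation from hypotheses

same? : (t u : Term) → Maybe (t ≡ u)
same? S       S         = just refl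
same? K       K         = just refl
same? (var i) (var j)   = Maybe.map (cong var) (dec⇒maybe (i ≟ j))
same? (t · u) (t′ · u′) = zipWith (cong₂ _·_) (same? t t′) (same? u u′)
same? _       _         = nothing

member? : ∀ t Γ → Maybe (t ∈ Γ)
member? t []      = nothing
member? t (u ∷ Γ) = Maybe.map here (same? t u) <∣> Maybe.map there (member? t Γ)

infix 4 _⇒_ _⊢_
_⇒_ : Term → Term → Set
t ⇒ u = ∀ {k} (v : Vec Comb k) → ⟦ t ⟧ v ⟶ ⟦ u ⟧ v

-- Only the head redex is contracted. A symbolic step is a step of every instance, so a normal form
-- of the reduct is one of the original.
headStep : ∀ t → Maybe (∃ (t ⇒_))
headStep (K · t · u)     = just (t , λ v → K-red)
headStep (S · t · u · w) = just (t · w · (u · w) , λ v → S-red)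
headStep (t · u)         = Maybe.map (λ (t′ , r) → t′ · u , λ v → appˡ (r v)) (headStep t)
headStep _               = nothing

_⊢_ : List Term → Term → Set
Γ ⊢ t = ∀ {k} (v : Vec Comb k) → Normalises Γ v → 𝒲𝒩 (⟦ t ⟧ v)

-- A sound but incomplete search: syntactic membership in the hypotheses first, then descent below
-- an S or K with too few arguments, then head reduction. A term with a variable head succeeds only
-- as a hypothesis. Fuel is there because head reduction need not terminate.
prove : (fuel : ℕ) → ∀ Γ t → Maybe (Γ ⊢ t)
prove zero    Γ t = nothing
prove (suc n) Γ t =
  Maybe.map (λ t∈Γ v hs → All.lookup hs t∈Γ) (member? t Γ) <∣> (irreducible t <∣> reducible)
  where
  irreducible : ∀ t → Maybe (Γ ⊢ t)
  irreducible S           = just λ v hs → 𝒲𝒩-S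
  irreducible K           = just λ v hs → 𝒲𝒩-K
  irreducible (S · t)     = Maybe.map (λ p v hs → 𝒲𝒩-S· (p v hs)) (prove n Γ t)
  irreducible (K · t)     = Maybe.map (λ p v hs → 𝒲𝒩-K· (p v hs)) (prove n Γ t)
  irreducible (S · t · u) =
    zipWith (λ p q v hs → 𝒲𝒩-S·· (p v hs) (q v hs)) (prove n Γ t) (prove n Γ u)
  irreducible _           = nothing

  reducible : Maybe (Γ ⊢ t)
  reducible with headStep t
  ... | just (t′ , r) = Maybe.map (λ p v hs → 𝒲𝒩-⟶ (r v) (p v hs)) (prove n Γ t′)
  ... | nothing       = nothing

proveAll : (fuel : ℕ) → ∀ Γ ts → Maybe (All (Γ ⊢_) ts)
proveAll n Γ []       = just []
proveAll n Γ (t ∷ ts) = zipWith _∷_ (prove n Γ t) (proveAll n Γ ts)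

-- Permutations and blocks of variables

insert : ∀ {A : Set} {k} → ℕ → A → Vec A k → Vec A (suc k)
insert zero    x v       = x ∷ v
insert (suc i) x []      = x ∷ []
insert (suc i) x (y ∷ v) = y ∷ insert i x v

-- Entry i of the code is the position of the head among the positions not yet taken.
permute : ∀ {A : Set} {k} → List ℕ → Vec A k → Vec A k
permute []      v       = v
permute (i ∷ c) []      = []
permute (i ∷ c) (x ∷ v) = insert i x (permute c v)

map-insert : ∀ {A B : Set} {k} (f : A → B) i x (v : Vec A k) →
  Vec.map f (insert i x v) ≡ insert i (f x) (Vec.map f v)
map-insert f zero    x v       = refl
map-insert f (suc i) x []      = refl
map-insert f (suc i) x (y ∷ v) = cong (f y ∷_) (map-insert f i x v)

map-permute : ∀ {A B : Set} {k} (f : A → B) c (v : Vec A k) →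
  Vec.map f (permute c v) ≡ permute c (Vec.map f v)
map-permute f []      v       = refl
map-permute f (i ∷ c) []      = refl
map-permute f (i ∷ c) (x ∷ v) =
  trans (map-insert f i x (permute c v)) (cong (insert i (f x)) (map-permute f c v))

insert-injective : ∀ {A : Set} {k} i {x y : A} {v w : Vec A k} →
  insert i x v ≡ insert i y w → x ≡ y × v ≡ w
insert-injective zero                            refl = refl , refl
insert-injective (suc i) {v = []}    {w = []}    refl = refl , refl
insert-injective (suc i) {v = _ ∷ _} {w = _ ∷ _} e
  with refl ← Vecₚ.∷-injectiveˡ e | refl , refl ← insert-injective i (Vecₚ.∷-injectiveʳ e)
  = refl , refl

permute-injective : ∀ {A : Set} {k} c {v w : Vec A k} → permute c v ≡ permute c w → v ≡ w
permute-injective []      e = e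
permute-injective (i ∷ c) {[]}    {[]}    e = refl
permute-injective (i ∷ c) {x ∷ v} {y ∷ w} e
  with refl , e′ ← insert-injective i e = cong (x ∷_) (permute-injective c e′)

∥insert∥ : ∀ {k} i M (v : Vec Comb k) → ∥ insert i M v ∥ ≡ size M + ∥ v ∥
∥insert∥ zero    M v       = refl
∥insert∥ (suc i) M []      = refl
∥insert∥ (suc i) M (N ∷ v) =
  trans (cong (_+_ (size N)) (∥insert∥ i M v)) (x+[y+z]≡y+[x+z] (size N) (size M) ∥ v ∥)

∥permute∥ : ∀ {k} c (v : Vec Comb k) → ∥ permute c v ∥ ≡ ∥ v ∥
∥permute∥ []      v       = refl
∥permute∥ (i ∷ c) []      = refl
∥permute∥ (i ∷ c) (M ∷ v) =
  trans (∥insert∥ i M (permute c v)) (cong (_+_ (size M)) (∥permute∥ c v))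

varsFrom : ℕ → ∀ k → Vec Term k
varsFrom o zero    = []
varsFrom o (suc k) = var o ∷ varsFrom (suc o) k

-- That `w` continues with `u` and then `r` from position `o` on is stated entry by entry through
-- the total function `at`. This avoids casts between vector lengths.
eval-varsFrom : ∀ o {k l m} (u : Vec Comb k) (r : Vec Comb l) (w : Vec Comb m) →
  (∀ i → at S w (o + i) ≡ at S (u Vec.++ r) i) → eval w (varsFrom o k) ≡ u
eval-varsFrom o []      r w h = refl
eval-varsFrom o (M ∷ u) r w h = cong₂ _∷_
  (trans (cong (at S w) (sym (+-identityʳ o))) (h 0))
  (eval-varsFrom (suc o) u r w (λ i → trans (cong (at S w) (sym (+-suc o i))) (h (suc i))))

at-++ : ∀ {k l} (u : Vec Comb k) (r : Vec Comb l) i → at S (u Vec.++ r) (k + i) ≡ at S r i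
at-++ []      r i = refl
at-++ (M ∷ u) r i = at-++ u r i

-- Systems of states

Heavy-nil : ∀ q → Heavy {0} (λ _ → ⊤) q q
Heavy-nil q = record
  { bound = 0 ; elems = [] ∷ [] ; unique = [] ∷ [] ; sound = (tt , z≤n) ∷ []
  ; heavy = ≤-refl }

-- The iteration x ↦ 2 + x²/8, started at 2, stays above 4 - 8/(n+4).
Heavy-⊤ : ∀ n → Heavy {1} (λ _ → ⊤) (4 * (2 + n)) (4 + n)
Heavy-⊤ zero = Heavy-rescale {p = 4 + (4 + 0)} {q = 4} ≤-refl
  (Heavy-split z≤n (Heavy-nil 4) (Heavy-nil 4) (Heavy-zero _ 4))
Heavy-⊤ (suc n) =
  Heavy-rescale {p = q * q + (q * q + c)} {{m*n≢0 q q}}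
    (≤-trans (m≤m+n _ 8) (≤-reflexive (lemma₂ n)))
    (Heavy-split (≤-reflexive (lemma₁ n)) (Heavy-nil (q * q)) (Heavy-nil (q * q))
      (Heavy-mono _ (Heavy-⊗ (Heavy-⊤ n) (Heavy-⊤ n))))
  where
  q = 4 + n
  -- With x = 4(2+n)/(4+n), the quotient of `c` by `q * q` is x²/8. The fixed point 4 is a double
  -- root, hence the gap of order 1/n.
  c = 2 * (2 + n) * (2 + n)
  lemma₁ : ∀ n → 8 * (2 * (2 + n) * (2 + n)) ≡ 4 * (2 + n) * (4 * (2 + n))
  lemma₁ = solve-∀
  lemma₂ : ∀ n → 4 * (3 + n) * ((4 + n) * (4 + n)) + 8 ≡
    ((4 + n) * (4 + n) + ((4 + n) * (4 + n) + 2 * (2 + n) * (2 + n))) * (5 + n)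
  lemma₂ = solve-∀

Dense-⊤ : ∀ q → Dense {1} (λ _ → ⊤) q q
Dense-⊤ q = record
  { threshold = 0
  ; dense = λ n _ → forests n 1 , forests-unique n 1 ,
      All.map (tt ,_) (forests-sound n 1) , ≤-refl }

-- The indices of the states whose product implies the goal, the number of variables
-- that are left over, and the permutation from the order in which the product lists
-- the variables to the order in which the goal does.
Plan : Set
Plan = List ℕ × ℕ × List ℕ

-- A state has rank + 1 variables.  The branches split variable 0; one without a plan
-- contributes 0.
record State : Set where
  constructor state
  field
    rank         : ℕ
    goals        : List Term
    onS onK on·  : Maybe Plan
open State

glueTerms : ∀ {k} → Vec Term (2 + k) → Vec Term (1 + k)
glueTerms (t ∷ u ∷ σ) = t · u ∷ σ

eval-glue : ∀ {k l} (v : Vec Comb l) (σ : Vec Term (2 + k)) →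
  eval v (glueTerms σ) ≡ glue (eval v σ)
eval-glue v (t ∷ u ∷ σ) = refl

nth : ∀ {A : Set} → A → List A → ℕ → A
nth d []       i       = d
nth d (x ∷ xs) zero    = x
nth d (x ∷ xs) (suc i) = nth d xs i

nth-map : ∀ {A B : Set} (R : A → B → Set) (f : A → B) {d e} → R d e →
  ∀ {xs} → All (λ x → R x (f x)) xs → ∀ i → R (nth d xs i) (nth e (List.map f xs) i)
nth-map R f r []       i       = r
nth-map R f r (p ∷ ps) zero    = p
nth-map R f r (p ∷ ps) (suc i) = nth-map R f r ps i

-- Verification of the plans

module Table (table : List State) where

  -- An index out of range denotes a state without goals. `bound` gives it `(0 , 0)`, which is a
  -- valid measure, so indices in plans need no range check.
  lookupState : ℕ → State
  lookupState = nth (state 0 [] nothing nothing nothing) table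

  arity : ℕ → ℕ
  arity j = suc (rank (lookupState j))

  Good : (s : State) → Pred (Vec Comb (suc (rank s))) 0ℓ
  Good s = Normalises (goals s)

  total : List ℕ → ℕ → ℕ
  total js e = List.foldr (λ j m → arity j + m) e js

  -- Consecutive states receive disjoint blocks of variables, beginning at `o`. This independence is
  -- what lets their measures be multiplied.
  hypotheses : ℕ → List ℕ → List Term
  hypotheses o []       = []
  hypotheses o (j ∷ js) =
    instantiate (varsFrom o (arity j)) (goals (lookupState j)) ++ hypotheses (o + arity j) js

  Justifies : ∀ {m} → Plan → Pred (Vec Comb m) 0ℓ → Set
  Justifies {m} (js , e , c) P =
    total js e ≡ m × (∀ {w} → Normalises (hypotheses 0 js) w → P (permute c w))

  -- The three branches differ only in how the split variable is put back. `fill` does this for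
  -- combinators and `fillT` for terms, and the goals so instantiated are derived symbolically.
  justify : ∀ {k m} (ts : List Term)
    (fill : Vec Comb m → Vec Comb k) (fillT : Vec Term m → Vec Term k) →
    (∀ {l} (v : Vec Comb l) σ → eval v (fillT σ) ≡ fill (eval v σ)) →
    ∀ p → Maybe (Justifies p (Normalises ts ∘ fill))
  justify {m = m} ts fill fillT eval-fill (js , e , c) = zipWith
    (λ eq ps → eq , λ {w} hs → subst (Normalises ts)
      (trans (eval-fill w (permute c (varsFrom 0 m)))
        (cong fill (trans (map-permute _ c (varsFrom 0 m))
          (cong (permute c) (eval-varsFrom 0 w [] w (at-++[] w))))))
      (Normalises-instantiate⁻ σ (All.map (λ p → p w hs) ps)))
    (dec⇒maybe (total js e ≟ m))
    -- The fuel 50 limits only the search; whatever is found is a proof.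
    (proveAll 50 (hypotheses 0 js) (instantiate σ ts))
    where
    σ = fillT (permute c (varsFrom 0 m))
    at-++[] : ∀ {k} (w : Vec Comb k) i → at S w i ≡ at S (w Vec.++ []) i
    at-++[] []      i       = refl
    at-++[] (M ∷ w) zero    = refl
    at-++[] (M ∷ w) (suc i) = at-++[] w i

  Justified : ∀ {m} → Maybe Plan → Pred (Vec Comb m) 0ℓ → Set
  Justified nothing  P = ⊤
  Justified (just p) P = Justifies p P

  record Sound (s : State) : Set where
    constructor sound
    field
      soundS : Justified (onS s) (Good s ∘ (S ∷_))
      soundK : Justified (onK s) (Good s ∘ (K ∷_))
      sound· : Justified (on· s) (Good s ∘ glue)

  check : ∀ s → Maybe (Sound s)
  check s = zipWith (λ p (q , r) → sound p q r)
    (branch (S ∷_) (S ∷_) (λ _ _ → refl) (onS s))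
    (zipWith _,_ (branch (K ∷_) (K ∷_) (λ _ _ → refl) (onK s))
                 (branch glue glueTerms eval-glue (on· s)))
    where
    branch : ∀ {m} (fill : Vec Comb m → Vec Comb _) (fillT : Vec Term m → Vec Term _) →
      (∀ {l} (v : Vec Comb l) σ → eval v (fillT σ) ≡ fill (eval v σ)) →
      ∀ p → Maybe (Justified p (Good s ∘ fill))
    branch fill fillT h nothing  = just tt
    branch fill fillT h (just p) = justify (goals s) fill fillT h p

  checkAll : ∀ ss → Maybe (All Sound ss)
  checkAll []       = just []
  checkAll (s ∷ ss) = zipWith _∷_ (check s) (checkAll ss)

  -- Pairs (g , d) are fixed-point numbers with denominator Q.  The weight 4 of an
  -- unconstrained variable is replaced by 4 - 8/(N+4).
  module Bounds (Q N : ℕ) .{{_ : NonZero Q}} where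

    Bound : Set
    Bound = ℕ × ℕ

    infixl 7 _⊙_
    _⊙_ : Bound → Bound → Bound
    (g , d) ⊙ (g′ , d′) = g * g′ div Q , (g * d′ + d * g′) div Q

    arbitrary : Bound
    arbitrary = 4 * (2 + N) * Q div (4 + N) , Q

    -- The starting value `(Q , 0)` measures the one empty vector, of weight 1 and density 0. It is
    -- the unit of `_⊙_`.
    erased : ℕ → Bound
    erased zero    = Q , 0
    erased (suc e) = arbitrary ⊙ erased e

    bound : List Bound → ℕ → Bound
    bound = nth (0 , 0)

    planBound : List Bound → Maybe Plan → Bound
    planBound bs nothing             = 0 , 0
    planBound bs (just (js , e , _)) = List.foldr (λ j b → bound bs j ⊙ b) (erased e) js

    branchSum : Bound → Bound → Bound → Bound
    branchSum (g , d) (g′ , d′) (g″ , d″) = g + (g′ + g″ div 8) , d + (d′ + d″ div 8)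

    stateBound : List Bound → State → Bound
    stateBound bs s =
      branchSum (planBound bs (onS s)) (planBound bs (onK s)) (planBound bs (on· s))

    -- The empty list reads as `(0 , 0)` at every index, which starts the iteration from zero. Each
    -- round is by itself a valid family of lower bounds, because all divisions round down.
    bounds : ℕ → List Bound
    bounds zero    = []
    bounds (suc n) = List.map (stateBound (bounds n)) table

    Measured : ∀ {k} → Pred (Vec Comb k) 0ℓ → Bound → Set
    Measured P b = Heavy P (proj₁ b) Q × Dense P (proj₂ b) Q

    module _ {k} {P : Pred (Vec Comb k) 0ℓ} where

      Measured-mono : ∀ {R : Pred (Vec Comb k) 0ℓ} {b} → P ⊆ R → Measured P b → Measured R b
      Measured-mono P⊆R (h , d) = Heavy-mono P⊆R h , Dense-mono P⊆R d

      Measured-⊗ : ∀ {l} {R : Pred (Vec Comb l) 0ℓ} {b b′} → Measured P b → Measured R b′ →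
        Measured (P ⊗ R) (b ⊙ b′)
      Measured-⊗ {b = g , d} {g′ , d′} (h , D) (h′ , D′) =
        Heavy-rescale {{m*n≢0 Q Q}} (floor (g * g′)) (Heavy-⊗ h h′) ,
        Dense-rescale {{m*n≢0 Q Q}} (floor (g * d′ + d * g′)) (Dense-⊗ h h′ D D′)
        where
        -- Products have denominator `Q * Q`; rounding down brings them back to `Q`.
        floor : ∀ x → x div Q * (Q * Q) ≤ x * Q
        floor x = ≤-trans (≤-reflexive (sym (*-assoc (x div Q) Q Q))) (*-monoˡ-≤ Q (m/n*n≤m x Q))

    Measured-split : ∀ {k} {P : Pred (Vec Comb (suc k)) 0ℓ} {a b c} → Measured (P ∘ (S ∷_)) a →
      Measured (P ∘ (K ∷_)) b → Measured (P ∘ glue) c → Measured P (branchSum a b c)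
    Measured-split {c = g , d} (hS , dS) (hK , dK) (hG , dG) =
      Heavy-split (floor g) hS hK hG , Dense-split (floor d) dS dK dG
      where
      floor : ∀ x → 8 * (x div 8) ≤ x
      floor x = ≤-trans (≤-reflexive (*-comm 8 (x div 8))) (m/n*n≤m x 8)

    Measured-permute : ∀ {k} {P : Pred (Vec Comb k) 0ℓ} {b} c →
      Measured (P ∘ permute c) b → Measured P b
    Measured-permute c (h , d) =
      Heavy-map (permute c) (permute-injective c) (∥permute∥ c) id h ,
      Dense-map (permute c) (permute-injective c) (∥permute∥ c) id d

    Measured-zero : ∀ {k} (P : Pred (Vec Comb k) 0ℓ) → Measured P (0 , 0)
    Measured-zero P = Heavy-zero P Q , Dense-zero P Q

    Measured-arbitrary : Measured {1} (λ _ → ⊤) arbitrary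
    Measured-arbitrary = Heavy-rescale (m/n*n≤m _ (4 + N)) (Heavy-⊤ N) , Dense-⊤ Q

    Measured-erased : ∀ e → Measured {e} (λ _ → ⊤) (erased e)
    Measured-erased zero    = Heavy-nil Q , Dense-zero _ Q
    Measured-erased (suc e) =
      Measured-mono _ (Measured-⊗ Measured-arbitrary (Measured-erased e))

    module _ (bs : List Bound)
      (valid : ∀ j → Measured (Good (lookupState j)) (bound bs j)) where

      -- The product consumes `r` block by block from the front, while the hypotheses name positions
      -- in the whole vector. The induction therefore needs every ambient `w` that agrees with `r`
      -- from an offset `o` on.
      Measured-hypotheses : ∀ js e → Measured {total js e}
        (λ r → ∀ o {m} (w : Vec Comb m) → (∀ i → at S w (o + i) ≡ at S r i) →
          Normalises (hypotheses o js) w)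
        (planBound bs (just (js , e , [])))
      Measured-hypotheses []       e = Measured-mono (λ _ _ {_} _ _ → []) (Measured-erased e)
      Measured-hypotheses (j ∷ js) e = Measured-mono
        (λ { {_} (u , r , refl , n , ns) o {_} w h → Allₚ.++⁺
          (Normalises-instantiate⁺ (varsFrom o (arity j))
            (subst (Good (lookupState j)) (sym (eval-varsFrom o u r w h)) n))
          (ns (o + arity j) w λ i →
            trans (cong (at S w) (+-assoc o (arity j) i))
              (trans (h (arity j + i)) (at-++ u r i))) })
        (Measured-⊗ (valid j) (Measured-hypotheses js e))

      Measured-plan : ∀ {m} {P : Pred (Vec Comb m) 0ℓ} p → Justified p P →
        Measured P (planBound bs p)
      Measured-plan nothing             _          = Measured-zero _
      Measured-plan (just (js , e , c)) (refl , h) = Measured-permute c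
        (Measured-mono (λ {w} n → h (n 0 w (λ _ → refl))) (Measured-hypotheses js e))

      Measured-state : ∀ {s} → Sound s → Measured (Good s) (stateBound bs s)
      Measured-state {s} (sound p q r) = Measured-split
        (Measured-plan (onS s) p) (Measured-plan (onK s) q) (Measured-plan (on· s) r)

    Measured-bounds : All Sound table → ∀ n j →
      Measured (Good (lookupState j)) (bound (bounds n) j)
    Measured-bounds ss zero    j = Measured-zero _
    Measured-bounds ss (suc n) j =
      nth-map (λ s b → Measured (Good s) b) (stateBound (bounds n)) (Measured-zero _)
        (All.map (Measured-state (bounds n) (Measured-bounds ss n)) ss) j

-- Found by a best-first search from the state {a}, then pruned as far as the bound allows.
table : List State
table =
  -- 0
  state 0 (a ∷ [])
    (just ([] , 0 , [])) (just ([] , 0 , [])) (just (1 ∷ [] , 0 , [])) ∷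
  state 1 (a · b ∷ [])
    (just (0 ∷ [] , 0 , [])) (just (0 ∷ [] , 0 , [])) (just (2 ∷ [] , 0 , [])) ∷
  state 2 (a · b · c ∷ [])
    (just (0 ∷ 0 ∷ [] , 0 , [])) (just (0 ∷ [] , 1 , [])) (just (3 ∷ [] , 0 , [])) ∷
  -- A typical row: `S · b · c · d` reduces to `b · d · (c · d)`, the next-but-one state read at b,
  -- d, c; `K · b · c · d` reduces to `b · d` and leaves c over. In both cases the code `0 ∷ 1 ∷ []`
  -- turns b, d, c into b, c, d. An application as head gives the same shape with one more argument.
  state 3 (a · b · c · d ∷ [])
    (just (5 ∷ [] , 0 , 0 ∷ 1 ∷ [])) (just (1 ∷ [] , 1 , 0 ∷ 1 ∷ [])) (just (4 ∷ [] , 0 , [])) ∷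
  state 4 (a · b · c · d · e ∷ [])
    (just (7 ∷ [] , 0 , 0 ∷ 1 ∷ [])) (just (2 ∷ [] , 1 , 0 ∷ 1 ∷ 1 ∷ [])) (just (6 ∷ [] , 0 , [])) ∷
  state 2 (a · b · (c · b) ∷ [])
    (just (10 ∷ [] , 0 , 1 ∷ [])) (just (0 ∷ [] , 1 , [])) (just (8 ∷ [] , 0 , [])) ∷
  state 5 (a · b · c · d · e · f ∷ [])
    (just (11 ∷ [] , 0 , 0 ∷ 1 ∷ [])) (just (3 ∷ [] , 1 , 0 ∷ 1 ∷ 1 ∷ 1 ∷ [])) (just (9 ∷ [] , 0 , [])) ∷
  state 3 (a · b · (c · b) · d ∷ [])
    (just (15 ∷ [] , 0 , 0 ∷ 1 ∷ [])) (just (1 ∷ [] , 1 , 0 ∷ 1 ∷ [])) (just (12 ∷ [] , 0 , [])) ∷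
  state 3 (a · b · c · (d · c) ∷ [])
    (just (16 ∷ [] , 0 , 0 ∷ 1 ∷ [])) (just (17 ∷ [] , 0 , 0 ∷ 1 ∷ [])) (just (13 ∷ [] , 0 , [])) ∷
  state 6 (a · b · c · d · e · f · g ∷ [])
    (just (18 ∷ [] , 0 , 0 ∷ 1 ∷ [])) (just (4 ∷ [] , 1 , 0 ∷ 1 ∷ 1 ∷ 1 ∷ 1 ∷ [])) (just (14 ∷ [] , 0 , [])) ∷
  -- 10
  state 1 (a · b ∷ b ∷ [])
    (just (0 ∷ [] , 0 , [])) (just (0 ∷ [] , 0 , [])) (just (19 ∷ [] , 0 , [])) ∷
  state 4 (a · b · (c · b) · d · e ∷ [])
    (just (24 ∷ [] , 0 , 0 ∷ 1 ∷ [])) (just (2 ∷ [] , 1 , 0 ∷ 1 ∷ 1 ∷ [])) (just (20 ∷ [] , 0 , [])) ∷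
  state 4 (a · b · c · (d · c) · e ∷ [])
    (just (25 ∷ [] , 0 , 0 ∷ 1 ∷ [])) (just (26 ∷ [] , 0 , 0 ∷ 1 ∷ [])) (just (21 ∷ [] , 0 , [])) ∷
  state 4 (a · b · c · d · (e · d) ∷ [])
    (just (27 ∷ [] , 0 , 0 ∷ 1 ∷ [])) (just (5 ∷ [] , 1 , 0 ∷ 1 ∷ 1 ∷ [])) (just (22 ∷ [] , 0 , [])) ∷
  state 7 (a · b · c · d · e · f · g · h ∷ [])
    (just (28 ∷ [] , 0 , 0 ∷ 1 ∷ [])) (just (6 ∷ [] , 1 , 0 ∷ 1 ∷ 1 ∷ 1 ∷ 1 ∷ 1 ∷ [])) (just (23 ∷ [] , 0 , [])) ∷
  -- Here the split variable occurs twice: `S · b · (c · S · b)` needs b and `c · S · b`, so a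
  -- primitive survives in the goals of state 36.
  state 2 (a · b · (c · a · b) ∷ [])
    (just (36 ∷ [] , 0 , 1 ∷ [])) (just (0 ∷ [] , 1 , [])) nothing ∷
  state 2 (a · (b · c) · (c · (b · c)) ∷ [])
    nothing (just (1 ∷ [] , 0 , [])) nothing ∷
  state 2 (a · (b · c) ∷ [])
    (just (1 ∷ [] , 0 , [])) (just (1 ∷ [] , 0 , [])) (just (29 ∷ [] , 0 , [])) ∷
  state 5 (a · b · (c · b) · d · e · f ∷ [])
    (just (37 ∷ [] , 0 , 0 ∷ 1 ∷ [])) (just (3 ∷ [] , 1 , 0 ∷ 1 ∷ 1 ∷ 1 ∷ [])) (just (30 ∷ [] , 0 , [])) ∷
  state 2 (a · b · c ∷ c ∷ [])
    (just (0 ∷ 0 ∷ [] , 0 , [])) (just (0 ∷ 0 ∷ [] , 0 , [])) (just (31 ∷ [] , 0 , [])) ∷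
  -- 20
  state 5 (a · b · c · (d · c) · e · f ∷ [])
    (just (38 ∷ [] , 0 , 0 ∷ 1 ∷ [])) (just (39 ∷ [] , 0 , 0 ∷ 1 ∷ [])) (just (32 ∷ [] , 0 , [])) ∷
  state 5 (a · b · c · d · (e · d) · f ∷ [])
    nothing (just (7 ∷ [] , 1 , 0 ∷ 1 ∷ 1 ∷ 1 ∷ [])) (just (33 ∷ [] , 0 , [])) ∷
  state 5 (a · b · c · d · e · (f · e) ∷ [])
    (just (40 ∷ [] , 0 , 0 ∷ 1 ∷ [])) (just (8 ∷ [] , 1 , 0 ∷ 1 ∷ 1 ∷ 1 ∷ [])) (just (34 ∷ [] , 0 , [])) ∷
  state 8 (a · b · c · d · e · f · g · h · i ∷ [])
    (just (41 ∷ [] , 0 , 0 ∷ 1 ∷ [])) (just (9 ∷ [] , 1 , 0 ∷ 1 ∷ 1 ∷ 1 ∷ 1 ∷ 1 ∷ 1 ∷ [])) (just (35 ∷ [] , 0 , [])) ∷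
  state 3 (a · b · (c · a · b) · d ∷ [])
    nothing (just (1 ∷ [] , 1 , 0 ∷ 1 ∷ [])) nothing ∷
  state 3 (a · (b · c) · (c · (b · c)) · d ∷ [])
    nothing (just (2 ∷ [] , 0 , [])) nothing ∷
  state 3 (a · (b · c) · d ∷ [])
    (just (1 ∷ 0 ∷ [] , 0 , [])) (just (1 ∷ [] , 1 , [])) (just (42 ∷ [] , 0 , [])) ∷
  state 3 (a · b · (c · b) · (d · b) ∷ [])
    nothing (just (45 ∷ [] , 1 , 0 ∷ 1 ∷ [])) nothing ∷
  state 6 (a · b · (c · b) · d · e · f · g ∷ [])
    (just (46 ∷ [] , 0 , 0 ∷ 1 ∷ [])) (just (4 ∷ [] , 1 , 0 ∷ 1 ∷ 1 ∷ 1 ∷ 1 ∷ [])) nothing ∷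
  state 3 (a · b · (c · d) ∷ [])
    (just (0 ∷ 1 ∷ [] , 0 , [])) (just (0 ∷ [] , 2 , [])) (just (43 ∷ [] , 0 , [])) ∷
  -- 30
  state 6 (a · b · c · (d · c) · e · f · g ∷ [])
    nothing (just (47 ∷ [] , 0 , 0 ∷ 1 ∷ [])) nothing ∷
  state 3 (a · b · c · d ∷ d ∷ [])
    (just (48 ∷ [] , 0 , 0 ∷ 1 ∷ [])) (just (10 ∷ [] , 1 , 0 ∷ 1 ∷ [])) (just (44 ∷ [] , 0 , [])) ∷
  state 6 (a · b · c · d · (e · d) · f · g ∷ [])
    nothing (just (11 ∷ [] , 1 , 0 ∷ 1 ∷ 1 ∷ 1 ∷ 1 ∷ [])) nothing ∷
  state 6 (a · b · c · d · e · (f · e) · g ∷ [])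
    nothing (just (12 ∷ [] , 1 , 0 ∷ 1 ∷ 1 ∷ 1 ∷ 1 ∷ [])) nothing ∷
  state 6 (a · b · c · d · e · f · (g · f) ∷ [])
    nothing (just (13 ∷ [] , 1 , 0 ∷ 1 ∷ 1 ∷ 1 ∷ 1 ∷ [])) nothing ∷
  state 9 (a · b · c · d · e · f · g · h · i · j ∷ [])
    nothing (just (14 ∷ [] , 1 , 0 ∷ 1 ∷ 1 ∷ 1 ∷ 1 ∷ 1 ∷ 1 ∷ 1 ∷ [])) nothing ∷
  state 1 (a · S · b ∷ b ∷ [])
    (just (0 ∷ [] , 0 , [])) (just (0 ∷ [] , 0 , [])) nothing ∷
  state 4 (a · b · (c · a · b) · d · e ∷ [])
    nothing (just (2 ∷ [] , 1 , 0 ∷ 1 ∷ 1 ∷ [])) nothing ∷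
  state 4 (a · (b · c) · (c · (b · c)) · d · e ∷ [])
    nothing (just (3 ∷ [] , 0 , [])) nothing ∷
  state 4 (a · (b · c) · d · e ∷ [])
    (just (8 ∷ [] , 0 , 0 ∷ 0 ∷ 1 ∷ [])) (just (2 ∷ [] , 1 , 0 ∷ 0 ∷ 1 ∷ [])) (just (49 ∷ [] , 0 , [])) ∷
  -- 40
  state 4 (a · b · (c · b) · d · (e · d) ∷ [])
    nothing (just (5 ∷ [] , 1 , 0 ∷ 1 ∷ 1 ∷ [])) nothing ∷
  state 7 (a · b · (c · b) · d · e · f · g · h ∷ [])
    nothing (just (6 ∷ [] , 1 , 0 ∷ 1 ∷ 1 ∷ 1 ∷ 1 ∷ 1 ∷ [])) nothing ∷
  state 4 (a · b · (c · d) · e ∷ [])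
    nothing (just (1 ∷ [] , 2 , 0 ∷ 2 ∷ [])) nothing ∷
  state 4 (a · b · c · (d · e) ∷ [])
    nothing (just (17 ∷ [] , 1 , 0 ∷ 1 ∷ 1 ∷ [])) nothing ∷
  state 4 (a · b · c · d · e ∷ e ∷ [])
    nothing (just (19 ∷ [] , 1 , 0 ∷ 1 ∷ 1 ∷ [])) nothing ∷
  state 1 (a · (b · a) ∷ [])
    nothing (just (50 ∷ [] , 0 , [])) nothing ∷
  state 5 (a · b · (c · a · b) · d · e · f ∷ [])
    nothing (just (3 ∷ [] , 1 , 0 ∷ 1 ∷ 1 ∷ 1 ∷ [])) nothing ∷
  state 5 (a · (b · c) · d · e · f ∷ [])
    (just (12 ∷ [] , 0 , 0 ∷ 0 ∷ 1 ∷ [])) (just (3 ∷ [] , 1 , 0 ∷ 0 ∷ 1 ∷ 1 ∷ [])) nothing ∷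
  state 2 (a · b · (c · b) ∷ b ∷ [])
    (just (10 ∷ [] , 0 , 1 ∷ [])) (just (0 ∷ [] , 1 , [])) nothing ∷
  state 5 (a · b · (c · d) · e · f ∷ [])
    nothing (just (2 ∷ [] , 2 , 0 ∷ 2 ∷ 2 ∷ [])) nothing ∷
  -- 50
  state 0 (a · K ∷ [])
    (just ([] , 0 , [])) (just ([] , 0 , [])) nothing ∷
  []
  where
  a b c d e f g h i j : Term
  a = var 0
  b = var 1
  c = var 2
  d = var 3
  e = var 4
  f = var 5
  g = var 6
  h = var 7
  i = var 8
  j = var 9

open Table table
-- Nine decimal places, and a weight of about 4 - 8 · 10^(-7) for an unconstrained argument. `N`
-- enters the bounds only through the closed form 4(2+N)/(4+N).
open Bounds 1000000000 10000000

table-sound : All Sound table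
-- Type checking runs the search on every row: `from-just` has this type only if the result is a
-- `just`.
table-sound = from-just (checkAll table)

-- From density to the lower limit

head-injective : ∀ {v w : Vec Comb 1} → Vec.head v ≡ Vec.head w → v ≡ w
head-injective {_ ∷ []} {_ ∷ []} refl = refl

∥head∥ : (v : Vec Comb 1) → size (Vec.head v) ≡ ∥ v ∥
∥head∥ (M ∷ []) = sym (+-identityʳ (size M))

𝒞-count : ∀ n → HasCount 𝒞 n (#comb n)
𝒞-count n = List.map Vec.head (forests n 1) , Uniqueₚ.map⁺ head-injective (forests-unique n 1) ,
  (λ M → mk⇔
    (λ M∈ → let v , v∈ , e = ∈-map⁻ Vec.head M∈ in
      _ , trans (cong size e) (trans (∥head∥ v) (All.lookup (forests-sound n 1) v∈)))
    (λ (_ , e) → ∈-map⁺ Vec.head (forests-complete n (M ∷ []) (trans (sym (∥head∥ (M ∷ []))) e)))) ,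
  length-map Vec.head (forests n 1)

/-< : ∀ p r d Q b k .{{_ : NonZero b}} .{{_ : NonZero r}} .{{_ : NonZero Q}} →
  p * Q < d * r → d * b ≤ Q * k → (+ p) / r ℚᵘ.< (+ k) / b
/-< p r@(suc _) d Q b@(suc _) k h l = ℚᵘ.*<*
  (subst₂ ℤ._<_ (ℤₚ.pos-* p b) (ℤₚ.pos-* k r) (ℤ.+<+ (*-cancelˡ-< Q _ _ (begin-strict
    Q * (p * b)   ≡⟨ lemma₁ Q p b ⟩
    p * Q * b     <⟨ *-monoˡ-< b h ⟩
    d * r * b     ≡⟨ lemma₂ d r b ⟩
    d * b * r     ≤⟨ *-monoˡ-≤ r l ⟩
    Q * k * r     ≡⟨ *-assoc Q k r ⟩
    Q * (k * r)   ∎))))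
  where
  open ≤-Reasoning
  lemma₁ : ∀ Q p b → Q * (p * b) ≡ p * Q * b
  lemma₁ = solve-∀
  lemma₂ : ∀ d r b → d * r * b ≡ d * b * r
  lemma₂ = solve-∀

-- The infimum of cuts asks for one rational above q and strictly below all ratios past the
-- threshold. Since p/r < d/Q holds strictly, p/r itself is that rational.
Dense⇒≤μ⁻ : ∀ p r {d Q} .{{_ : NonZero r}} .{{_ : NonZero Q}} →
  Dense {1} (Normalises (var 0 ∷ [])) d Q → p * Q < d * r → fromℚ ((+ p) / r) ≤ᴿ μ⁻ 𝒲𝒩 𝒞
Dense⇒≤μ⁻ p r {d} {Q} D h q< = threshold , (+ p) / r , q< , λ (n , t≤n) →
  let xs , xs! , xs-sound , xs-dense = dense n t≤n in
  length xs , #comb n ,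
  (List.map Vec.head xs , Uniqueₚ.map⁺ head-injective xs! ,
    Allₚ.map⁺ (All.map (λ { {M ∷ []} (wn ∷ [] , e) → wn , trans (∥head∥ (M ∷ [])) e }) xs-sound) ,
    length-map Vec.head xs) ,
  𝒞-count n , #comb≢0 n , /-< p r d Q (#comb n) (length xs) {{#comb≢0 n}} h xs-dense
  where open Dense D

mainTheorem6 : fromℚ ((+ 34010402598726164) / 100000000000000000) ≤ᴿ μ⁻ 𝒲𝒩 𝒞
mainTheorem6 = Dense⇒≤μ⁻ 34010402598726164 100000000000000000
  -- State 0 is the single goal `a`. After 60 rounds its density numerator over 10^9 is at least
  -- 340104026, the least integer above the claim; the comparison is decided by evaluation.
  (proj₂ (Measured-bounds table-sound 60 0)) (<ᵇ⇒< _ _ tt)
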